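{- For every $s\in\mathbb C$ and all $n\ge 1$, the function $$f_s(x)=\dfrac{\sin x+1}{\cos^2x}+s\,\sin x$$ satisfies $$\ddot H_n(f_s)=\Bigl(1-s\tbinom n2\Bigr)\prod_{k=1}^{n-1}(k!)^2\,(2k+1)!!.$$ In particular, for $s=-1$, where $f_{ -1}(x)=(\sin^3x+1)/\cos^2x$, $$\ddot H_n(f_{ -1})=\Bigl(\binom n2+1\Bigr)\prod_{k=1}^{n-1}(k!)^2\,(2k+1)!!.$$
   Context: For a power series $f(x)=\sum_{k\ge0}a_kx^k/k!$, the dilated Hankel determinant is $\ddot H_n(f)=\det(a_{2i+j})_{0\le i,j\le n-1}$. $(2k+1)!!=1\cdot3\cdot5\cdots(2k+1)$; empty products equal $1$. -}

module Defs where

open import Level using (_⊔_; 0ℓ)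
open import Algebra.Bundles using (CommutativeRing; Semiring)
import Algebra.Definitions.RawSemiring as RawSemiringDefs
open import Algebra.Morphism.Structures using (IsRingHomomorphism)
open import Data.Fin.Base using (Fin; zero; suc; toℕ; punchIn)
open import Data.List.Base using (applyUpTo)
open import Data.Nat.Base as ℕ using (ℕ; zero; suc; _∸_; _!)
import Data.Nat.Properties as ℕ
open import Data.Nat.ListAction using (product)
open import Data.Integer.Base using (+_)
open import Data.Product.Base using (∃-syntax; _,_; proj₁; proj₂)
open import Data.Rational.Base as ℚ using (ℚ; 0ℚ; 1ℚ; ½; ∣_∣)
import Data.Rational.Properties as ℚ
open import Data.Sum.Base using (inj₁; inj₂)
open import Data.Vec.Base using (Vec; []; _∷_; lookup; head)
open import Relation.Nullary.Decidable.Core using (dec⇒maybe)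
open import Relation.Binary.PropositionalEquality as ≡ using (_≡_)
open import Relation.Binary.Structures using (IsEquivalence)
import Relation.Binary.Reasoning.Setoid as SetoidReasoning
open import Tactic.RingSolver using (solve-∀)
open import Tactic.RingSolver.Core.AlmostCommutativeRing
  using (AlmostCommutativeRing; fromCommutativeRing)

private
  ℚ-acr : AlmostCommutativeRing 0ℓ 0ℓ
  ℚ-acr = fromCommutativeRing ℚ.+-*-commutativeRing (λ q → dec⇒maybe (0ℚ ℚ.≟ q))

Null : (ℕ → ℚ) → Set
Null u = ∀ ε → 0ℚ ℚ.< ε → ∃[ N ] ∀ n → N ℕ.≤ n → ∣ u n ∣ ℚ.< ε

Cauchy : (ℕ → ℚ) → Set
Cauchy u = ∀ ε → 0ℚ ℚ.< ε →
  ∃[ N ] ∀ m n → N ℕ.≤ m → N ℕ.≤ n → ∣ u m ℚ.- u n ∣ ℚ.< ε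

-- The reals are Cauchy sequences of rationals modulo null sequences; moduli of
-- convergence are part of the data, as ∃ is the constructive existential.
record ℝ : Set where
  no-eta-equality
  field
    seq    : ℕ → ℚ
    cauchy : Cauchy seq

open ℝ public

infix 4 _≈ᴿ_

record _≈ᴿ_ (x y : ℝ) : Set where
  constructor mk≈
  field
    null : Null (λ n → seq x n ℚ.- seq y n)

open _≈ᴿ_ public

private
  halves : ∀ ε → ½ ℚ.* ε ℚ.+ ½ ℚ.* ε ≡ ε
  halves ε = ≡.trans (≡.sym (ℚ.*-distribʳ-+ ε ½ ½)) (ℚ.*-identityˡ ε)

  half-pos : ∀ {ε} → 0ℚ ℚ.< ε → 0ℚ ℚ.< ½ ℚ.* ε
  half-pos {ε} 0<ε =
    ≡.subst (ℚ._< ½ ℚ.* ε) (ℚ.*-zeroʳ ½) (ℚ.*-monoʳ-<-pos ½ 0<ε)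

  sum-small : ∀ {ε} p q → ∣ p ∣ ℚ.< ½ ℚ.* ε → ∣ q ∣ ℚ.< ½ ℚ.* ε → ∣ p ℚ.+ q ∣ ℚ.< ε
  sum-small {ε} p q p< q< = ≡.subst (∣ p ℚ.+ q ∣ ℚ.<_) (halves ε)
    (ℚ.≤-<-trans (ℚ.∣p+q∣≤∣p∣+∣q∣ p q) (ℚ.+-mono-< p< q<))

  _/′_ : (p q : ℚ) → .{{ℚ.Positive q}} → ℚ
  p /′ q = p ℚ.* (ℚ.1/ q) {{ℚ.pos⇒nonZero q}}

  quot-pos : ∀ {ε} B → .{{_ : ℚ.Positive B}} → 0ℚ ℚ.< ε → 0ℚ ℚ.< ε /′ B
  quot-pos {ε} B 0<ε = ≡.subst (ℚ._< ε /′ B) (ℚ.*-zeroˡ c)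
    (ℚ.*-monoˡ-<-pos c {{ℚ.1/pos⇒pos B}} 0<ε)
    where c = (ℚ.1/ B) {{ℚ.pos⇒nonZero B}}

  prod-small : ∀ {ε} B → .{{_ : ℚ.Positive B}} → ∀ p q →
               ∣ p ∣ ℚ.≤ B → ∣ q ∣ ℚ.< ε /′ B → ∣ p ℚ.* q ∣ ℚ.< ε
  prod-small {ε} B p q p≤ q< = begin-strict
    ∣ p ℚ.* q ∣      ≡⟨ ℚ.∣p*q∣≡∣p∣*∣q∣ p q ⟩
    ∣ p ∣ ℚ.* ∣ q ∣  ≤⟨ ℚ.*-monoʳ-≤-nonNeg ∣ q ∣ {{ℚ.nonNegative (ℚ.0≤∣p∣ q)}} p≤ ⟩
    B ℚ.* ∣ q ∣      <⟨ ℚ.*-monoʳ-<-pos B q< ⟩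
    B ℚ.* (ε /′ B)   ≡⟨ swap B ε ((ℚ.1/ B) {{ℚ.pos⇒nonZero B}}) ⟩
    ε ℚ.* (B ℚ.* (ℚ.1/ B) {{ℚ.pos⇒nonZero B}})
      ≡⟨ ≡.cong (ε ℚ.*_) (ℚ.*-inverseʳ B {{ℚ.pos⇒nonZero B}}) ⟩
    ε ℚ.* 1ℚ         ≡⟨ ℚ.*-identityʳ ε ⟩
    ε                ∎
    where
    open ℚ.≤-Reasoning
    swap : ∀ a b c → a ℚ.* (b ℚ.* c) ≡ b ℚ.* (a ℚ.* c)
    swap = solve-∀ ℚ-acr

  maxPrefix : (ℕ → ℚ) → ℕ → ℚ
  maxPrefix u zero    = 1ℚ
  maxPrefix u (suc N) = maxPrefix u N ℚ.+ ∣ u N ∣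

  maxPrefix-pos : ∀ u N → ℚ.Positive (maxPrefix u N)
  maxPrefix-pos u zero    = _
  maxPrefix-pos u (suc N) = ℚ.pos+nonNeg⇒pos (maxPrefix u N) {{maxPrefix-pos u N}}
                              ∣ u N ∣ {{ℚ.nonNegative (ℚ.0≤∣p∣ (u N))}}

  maxPrefix-bound : ∀ u N n → n ℕ.< N → ∣ u n ∣ ℚ.≤ maxPrefix u N
  maxPrefix-bound u (suc N) n (ℕ.s≤s n≤N) with ℕ.m≤n⇒m<n∨m≡n n≤N
  ... | inj₁ n<N    = ℚ.≤-trans (maxPrefix-bound u N n n<N)
                        (≡.subst (ℚ._≤ maxPrefix u N ℚ.+ ∣ u N ∣) (ℚ.+-identityʳ _)
                          (ℚ.+-monoʳ-≤ (maxPrefix u N) (ℚ.0≤∣p∣ (u N))))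
  ... | inj₂ ≡.refl = ≡.subst (ℚ._≤ maxPrefix u N ℚ.+ ∣ u N ∣) (ℚ.+-identityˡ _)
                        (ℚ.+-monoˡ-≤ ∣ u N ∣
                          (ℚ.<⇒≤ (ℚ.positive⁻¹ (maxPrefix u N) {{maxPrefix-pos u N}})))

  record Bounded (u : ℕ → ℚ) : Set where
    field
      bound   : ℚ
      pos     : ℚ.Positive bound
      bounded : ∀ n → ∣ u n ∣ ℚ.≤ bound

  cauchy⇒bounded : ∀ u → Cauchy u → Bounded u
  cauchy⇒bounded u cau with cau 1ℚ (ℚ.positive⁻¹ 1ℚ)
  ... | N , close = record { bound = B ; pos = B-pos ; bounded = bdd }
    where
    P = maxPrefix u (suc N)
    B = 1ℚ ℚ.+ P
    P-pos : ℚ.Positive P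
    P-pos = maxPrefix-pos u (suc N)
    B-pos : ℚ.Positive B
    B-pos = ℚ.pos+pos⇒pos 1ℚ P {{P-pos}}
    split : ∀ a b → a ≡ (a ℚ.- b) ℚ.+ b
    split = solve-∀ ℚ-acr
    bdd : ∀ n → ∣ u n ∣ ℚ.≤ B
    bdd n with ℕ.≤-<-connex N n
    ... | inj₂ n<N = ℚ.≤-trans (maxPrefix-bound u (suc N) n (ℕ.m<n⇒m<1+n n<N))
                       (≡.subst (ℚ._≤ B) (ℚ.+-identityˡ P)
                         (ℚ.+-monoˡ-≤ P (ℚ.<⇒≤ (ℚ.positive⁻¹ 1ℚ))))
    ... | inj₁ N≤n = begin
      ∣ u n ∣                            ≡⟨ ≡.cong ∣_∣ (split (u n) (u N)) ⟩
      ∣ (u n ℚ.- u N) ℚ.+ u N ∣          ≤⟨ ℚ.∣p+q∣≤∣p∣+∣q∣ (u n ℚ.- u N) (u N) ⟩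
      ∣ u n ℚ.- u N ∣ ℚ.+ ∣ u N ∣        ≤⟨ ℚ.+-mono-≤ (ℚ.<⇒≤ (close n N N≤n ℕ.≤-refl))
                                             (maxPrefix-bound u (suc N) N (ℕ.n<1+n N)) ⟩
      B                                  ∎
      where open ℚ.≤-Reasoning

  null-cong : ∀ {u v} → (∀ n → u n ≡ v n) → Null u → Null v
  null-cong u≡v nu ε 0<ε with nu ε 0<ε
  ... | N , small = N , λ n N≤n → ≡.subst (λ t → ∣ t ∣ ℚ.< ε) (u≡v n) (small n N≤n)

  null-zero : Null (λ _ → 0ℚ)
  null-zero ε 0<ε = 0 , λ _ _ → 0<ε

  null-+ : ∀ {u v} → Null u → Null v → Null (λ n → u n ℚ.+ v n)
  null-+ {u} {v} nu nv ε 0<ε with nu (½ ℚ.* ε) (half-pos 0<ε) | nv (½ ℚ.* ε) (half-pos 0<ε)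
  ... | M , su | N , sv = M ℕ.⊔ N , λ n le → sum-small (u n) (v n)
    (su n (ℕ.≤-trans (ℕ.m≤m⊔n M N) le)) (sv n (ℕ.≤-trans (ℕ.m≤n⊔m M N) le))

  null-neg : ∀ {u} → Null u → Null (λ n → ℚ.- u n)
  null-neg {u} nu ε 0<ε with nu ε 0<ε
  ... | N , small = N , λ n N≤n →
    ≡.subst (ℚ._< ε) (≡.sym (ℚ.∣-p∣≡∣p∣ (u n))) (small n N≤n)

  null-* : ∀ {u v} → Bounded u → Null v → Null (λ n → u n ℚ.* v n)
  null-* {u} {v} b nv ε 0<ε with nv (ε /′ bound) (quot-pos bound 0<ε)
    where open Bounded b
          instance _ = pos
  ... | N , small = N , λ n N≤n → prod-small bound (u n) (v n) (bounded n) (small n N≤n)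
    where open Bounded b
          instance _ = pos

private
  cauchy-const : ∀ q → Cauchy (λ _ → q)
  cauchy-const q ε 0<ε =
    0 , λ _ _ _ _ → ≡.subst (λ t → ∣ t ∣ ℚ.< ε) (≡.sym (ℚ.+-inverseʳ q)) 0<ε

  cauchy-+ : ∀ u v → Cauchy u → Cauchy v → Cauchy (λ n → u n ℚ.+ v n)
  cauchy-+ u v cu cv ε 0<ε with cu (½ ℚ.* ε) (half-pos 0<ε) | cv (½ ℚ.* ε) (half-pos 0<ε)
  ... | M , su | N , sv = M ℕ.⊔ N , λ m n lm ln →
    ≡.subst (λ t → ∣ t ∣ ℚ.< ε) (regroup (u m) (v m) (u n) (v n))
      (sum-small (u m ℚ.- u n) (v m ℚ.- v n)
        (su m n (ℕ.≤-trans (ℕ.m≤m⊔n M N) lm) (ℕ.≤-trans (ℕ.m≤m⊔n M N) ln))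
        (sv m n (ℕ.≤-trans (ℕ.m≤n⊔m M N) lm) (ℕ.≤-trans (ℕ.m≤n⊔m M N) ln)))
    where
    regroup : ∀ a b c d → (a ℚ.- c) ℚ.+ (b ℚ.- d) ≡ (a ℚ.+ b) ℚ.- (c ℚ.+ d)
    regroup = solve-∀ ℚ-acr

  cauchy-neg : ∀ u → Cauchy u → Cauchy (λ n → ℚ.- u n)
  cauchy-neg u cu ε 0<ε with cu ε 0<ε
  ... | N , su = N , λ m n lm ln → ≡.subst (ℚ._< ε)
    (≡.trans (≡.sym (ℚ.∣-p∣≡∣p∣ (u m ℚ.- u n))) (≡.cong ∣_∣ (regroup (u m) (u n))))
    (su m n lm ln)
    where
    regroup : ∀ a b → ℚ.- (a ℚ.- b) ≡ (ℚ.- a) ℚ.- (ℚ.- b)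
    regroup = solve-∀ ℚ-acr

  cauchy-* : ∀ u v → Bounded u → Bounded v → Cauchy u → Cauchy v →
             Cauchy (λ n → u n ℚ.* v n)
  cauchy-* u v bu bv cu cv ε 0<ε = M ℕ.⊔ N , λ m n lm ln →
    ≡.subst (λ t → ∣ t ∣ ℚ.< ε) (regroup (u m) (v m) (u n) (v n))
      (sum-small (u m ℚ.* (v m ℚ.- v n)) (v n ℚ.* (u m ℚ.- u n))
        (prod-small A (u m) (v m ℚ.- v n) (u≤A m)
          (proj₂ Nsv m n (ℕ.≤-trans (ℕ.m≤n⊔m M N) lm) (ℕ.≤-trans (ℕ.m≤n⊔m M N) ln)))
        (prod-small B (v n) (u m ℚ.- u n) (v≤B n)
          (proj₂ Msu m n (ℕ.≤-trans (ℕ.m≤m⊔n M N) lm) (ℕ.≤-trans (ℕ.m≤m⊔n M N) ln))))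
    where
    open Bounded bu renaming (bound to A; pos to A-pos; bounded to u≤A)
    open Bounded bv renaming (bound to B; pos to B-pos; bounded to v≤B)
    instance
      _ = A-pos
      _ = B-pos
    regroup : ∀ a b c d → a ℚ.* (b ℚ.- d) ℚ.+ d ℚ.* (a ℚ.- c) ≡ a ℚ.* b ℚ.- c ℚ.* d
    regroup = solve-∀ ℚ-acr
    Msu = cu ((½ ℚ.* ε) /′ B) (quot-pos B (half-pos 0<ε))
    Nsv = cv ((½ ℚ.* ε) /′ A) (quot-pos A (half-pos 0<ε))
    M = proj₁ Msu
    N = proj₁ Nsv

infixl 6 _+ᴿ_
infixl 7 _*ᴿ_
infix  8 -ᴿ_

fromℚᴿ : ℚ → ℝ
fromℚᴿ q .seq _  = q
fromℚᴿ q .cauchy = cauchy-const q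

_+ᴿ_ : ℝ → ℝ → ℝ
(x +ᴿ y) .seq n  = seq x n ℚ.+ seq y n
(x +ᴿ y) .cauchy = cauchy-+ (seq x) (seq y) (cauchy x) (cauchy y)

-ᴿ_ : ℝ → ℝ
(-ᴿ x) .seq n  = ℚ.- seq x n
(-ᴿ x) .cauchy = cauchy-neg (seq x) (cauchy x)

_*ᴿ_ : ℝ → ℝ → ℝ
(x *ᴿ y) .seq n  = seq x n ℚ.* seq y n
(x *ᴿ y) .cauchy = cauchy-* (seq x) (seq y) (cauchy⇒bounded (seq x) (cauchy x))
                            (cauchy⇒bounded (seq y) (cauchy y)) (cauchy x) (cauchy y)

private
  pointwise : ∀ {x y} → (∀ n → seq x n ≡ seq y n) → x ≈ᴿ y
  pointwise {x} {y} x≡y = mk≈ (null-cong eq null-zero)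
    where
    eq : ∀ n → 0ℚ ≡ seq x n ℚ.- seq y n
    eq n = ≡.trans (≡.sym (ℚ.+-inverseʳ (seq x n))) (≡.cong (λ t → seq x n ℚ.- t) (x≡y n))

  ≈ᴿ-isEquivalence : IsEquivalence _≈ᴿ_
  ≈ᴿ-isEquivalence = record
    { refl  = pointwise (λ _ → ≡.refl)
    ; sym   = λ {x} {y} p → mk≈ (null-cong (λ n → flip (seq x n) (seq y n)) (null-neg (null p)))
    ; trans = λ {x} {y} {z} p q → mk≈
        (null-cong (λ n → glue (seq x n) (seq y n) (seq z n)) (null-+ (null p) (null q)))
    }
    where
    flip : ∀ a b → ℚ.- (a ℚ.- b) ≡ b ℚ.- a
    flip = solve-∀ ℚ-acr
    glue : ∀ a b c → (a ℚ.- b) ℚ.+ (b ℚ.- c) ≡ a ℚ.- c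
    glue = solve-∀ ℚ-acr

  +ᴿ-cong : ∀ {x y u v} → x ≈ᴿ y → u ≈ᴿ v → x +ᴿ u ≈ᴿ y +ᴿ v
  +ᴿ-cong {x} {y} {u} {v} p q = mk≈
    (null-cong (λ n → regroup (seq x n) (seq y n) (seq u n) (seq v n))
      (null-+ (null p) (null q)))
    where
    regroup : ∀ a b c d → (a ℚ.- b) ℚ.+ (c ℚ.- d) ≡ (a ℚ.+ c) ℚ.- (b ℚ.+ d)
    regroup = solve-∀ ℚ-acr

  -ᴿ-cong : ∀ {x y} → x ≈ᴿ y → -ᴿ x ≈ᴿ -ᴿ y
  -ᴿ-cong {x} {y} p = mk≈
    (null-cong (λ n → regroup (seq x n) (seq y n)) (null-neg (null p)))
    where
    regroup : ∀ a b → ℚ.- (a ℚ.- b) ≡ (ℚ.- a) ℚ.- (ℚ.- b)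
    regroup = solve-∀ ℚ-acr

  *ᴿ-cong : ∀ {x y u v} → x ≈ᴿ y → u ≈ᴿ v → x *ᴿ u ≈ᴿ y *ᴿ v
  *ᴿ-cong {x} {y} {u} {v} p q = mk≈
    (null-cong (λ n → regroup (seq x n) (seq y n) (seq u n) (seq v n))
      (null-+ (null-* (cauchy⇒bounded (seq x) (cauchy x)) (null q))
              (null-* (cauchy⇒bounded (seq v) (cauchy v)) (null p))))
    where
    regroup : ∀ a b c d → a ℚ.* (c ℚ.- d) ℚ.+ d ℚ.* (a ℚ.- b) ≡ a ℚ.* c ℚ.- b ℚ.* d
    regroup = solve-∀ ℚ-acr

infix 5 _+i_
infix 4 _≈ᶜ_

record ℂ : Set where
  no-eta-equality
  constructor _+i_
  field
    re im : ℝ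

open ℂ public

record _≈ᶜ_ (z w : ℂ) : Set where
  constructor mk≈ᶜ
  field
    re≈ : re z ≈ᴿ re w
    im≈ : im z ≈ᴿ im w

open _≈ᶜ_ public

infixl 6 _+ᶜ_
infixl 7 _*ᶜ_
infix  8 -ᶜ_

fromℚ : ℚ → ℂ
fromℚ q .re = fromℚᴿ q
fromℚ q .im = fromℚᴿ 0ℚ

_+ᶜ_ : ℂ → ℂ → ℂ
(z +ᶜ w) .re = re z +ᴿ re w
(z +ᶜ w) .im = im z +ᴿ im w

-ᶜ_ : ℂ → ℂ
(-ᶜ z) .re = -ᴿ re z
(-ᶜ z) .im = -ᴿ im z

_*ᶜ_ : ℂ → ℂ → ℂ
(z *ᶜ w) .re = re z *ᴿ re w +ᴿ -ᴿ (im z *ᴿ im w)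
(z *ᶜ w) .im = re z *ᴿ im w +ᴿ im z *ᴿ re w

private
  pointwiseᶜ : ∀ {z w} → (∀ n → seq (re z) n ≡ seq (re w) n) →
               (∀ n → seq (im z) n ≡ seq (im w) n) → z ≈ᶜ w
  pointwiseᶜ p q = mk≈ᶜ (pointwise p) (pointwise q)

  open IsEquivalence ≈ᴿ-isEquivalence using ()
    renaming (refl to reflᴿ; sym to symᴿ; trans to transᴿ)

  ≈ᶜ-isEquivalence : IsEquivalence _≈ᶜ_
  ≈ᶜ-isEquivalence = record
    { refl  = mk≈ᶜ reflᴿ reflᴿ
    ; sym   = λ p → mk≈ᶜ (symᴿ (re≈ p)) (symᴿ (im≈ p))
    ; trans = λ p q → mk≈ᶜ (transᴿ (re≈ p) (re≈ q)) (transᴿ (im≈ p) (im≈ q))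
    }

  +ᶜ-cong : ∀ {x y u v} → x ≈ᶜ y → u ≈ᶜ v → x +ᶜ u ≈ᶜ y +ᶜ v
  +ᶜ-cong p q = mk≈ᶜ (+ᴿ-cong (re≈ p) (re≈ q)) (+ᴿ-cong (im≈ p) (im≈ q))

  -ᶜ-cong : ∀ {x y} → x ≈ᶜ y → -ᶜ x ≈ᶜ -ᶜ y
  -ᶜ-cong p = mk≈ᶜ (-ᴿ-cong (re≈ p)) (-ᴿ-cong (im≈ p))

  *ᶜ-cong : ∀ {x y u v} → x ≈ᶜ y → u ≈ᶜ v → x *ᶜ u ≈ᶜ y *ᶜ v
  *ᶜ-cong p q = mk≈ᶜ
    (+ᴿ-cong (*ᴿ-cong (re≈ p) (re≈ q)) (-ᴿ-cong (*ᴿ-cong (im≈ p) (im≈ q))))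
    (+ᴿ-cong (*ᴿ-cong (re≈ p) (im≈ q)) (*ᴿ-cong (im≈ p) (re≈ q)))

  *ᶜ-assoc : ∀ x y z → (x *ᶜ y) *ᶜ z ≈ᶜ x *ᶜ (y *ᶜ z)
  *ᶜ-assoc x y z = pointwiseᶜ
    (λ n → real (seq (re x) n) (seq (im x) n) (seq (re y) n) (seq (im y) n) (seq (re z) n) (seq (im z) n))
    (λ n → imag (seq (re x) n) (seq (im x) n) (seq (re y) n) (seq (im y) n) (seq (re z) n) (seq (im z) n))
    where
    real : ∀ a b c d e f →
      (a ℚ.* c ℚ.+ ℚ.- (b ℚ.* d)) ℚ.* e ℚ.+ ℚ.- ((a ℚ.* d ℚ.+ b ℚ.* c) ℚ.* f)
        ≡ a ℚ.* (c ℚ.* e ℚ.+ ℚ.- (d ℚ.* f)) ℚ.+ ℚ.- (b ℚ.* (c ℚ.* f ℚ.+ d ℚ.* e))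
    real = solve-∀ ℚ-acr
    imag : ∀ a b c d e f →
      (a ℚ.* c ℚ.+ ℚ.- (b ℚ.* d)) ℚ.* f ℚ.+ (a ℚ.* d ℚ.+ b ℚ.* c) ℚ.* e
        ≡ a ℚ.* (c ℚ.* f ℚ.+ d ℚ.* e) ℚ.+ b ℚ.* (c ℚ.* e ℚ.+ ℚ.- (d ℚ.* f))
    imag = solve-∀ ℚ-acr

  *ᶜ-comm : ∀ x y → x *ᶜ y ≈ᶜ y *ᶜ x
  *ᶜ-comm x y = pointwiseᶜ
    (λ n → real (seq (re x) n) (seq (im x) n) (seq (re y) n) (seq (im y) n))
    (λ n → imag (seq (re x) n) (seq (im x) n) (seq (re y) n) (seq (im y) n))
    where
    real : ∀ a b c d →
      a ℚ.* c ℚ.+ ℚ.- (b ℚ.* d)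
        ≡ c ℚ.* a ℚ.+ ℚ.- (d ℚ.* b)
    real = solve-∀ ℚ-acr
    imag : ∀ a b c d →
      a ℚ.* d ℚ.+ b ℚ.* c
        ≡ c ℚ.* b ℚ.+ d ℚ.* a
    imag = solve-∀ ℚ-acr

  *ᶜ-identityˡ : ∀ x → fromℚ 1ℚ *ᶜ x ≈ᶜ x
  *ᶜ-identityˡ x = pointwiseᶜ
    (λ n → real (seq (re x) n) (seq (im x) n))
    (λ n → imag (seq (re x) n) (seq (im x) n))
    where
    real : ∀ a b →
      1ℚ ℚ.* a ℚ.+ ℚ.- (0ℚ ℚ.* b)
        ≡ a
    real = solve-∀ ℚ-acr
    imag : ∀ a b →
      1ℚ ℚ.* b ℚ.+ 0ℚ ℚ.* a
        ≡ b
    imag = solve-∀ ℚ-acr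

  *ᶜ-identityʳ : ∀ x → x *ᶜ fromℚ 1ℚ ≈ᶜ x
  *ᶜ-identityʳ x = pointwiseᶜ
    (λ n → real (seq (re x) n) (seq (im x) n))
    (λ n → imag (seq (re x) n) (seq (im x) n))
    where
    real : ∀ a b →
      a ℚ.* 1ℚ ℚ.+ ℚ.- (b ℚ.* 0ℚ)
        ≡ a
    real = solve-∀ ℚ-acr
    imag : ∀ a b →
      a ℚ.* 0ℚ ℚ.+ b ℚ.* 1ℚ
        ≡ b
    imag = solve-∀ ℚ-acr

  *ᶜ-distribˡ : ∀ x y z → x *ᶜ (y +ᶜ z) ≈ᶜ x *ᶜ y +ᶜ x *ᶜ z
  *ᶜ-distribˡ x y z = pointwiseᶜ
    (λ n → real (seq (re x) n) (seq (im x) n) (seq (re y) n) (seq (im y) n) (seq (re z) n) (seq (im z) n))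
    (λ n → imag (seq (re x) n) (seq (im x) n) (seq (re y) n) (seq (im y) n) (seq (re z) n) (seq (im z) n))
    where
    real : ∀ a b c d e f →
      a ℚ.* (c ℚ.+ e) ℚ.+ ℚ.- (b ℚ.* (d ℚ.+ f))
        ≡ (a ℚ.* c ℚ.+ ℚ.- (b ℚ.* d)) ℚ.+ (a ℚ.* e ℚ.+ ℚ.- (b ℚ.* f))
    real = solve-∀ ℚ-acr
    imag : ∀ a b c d e f →
      a ℚ.* (d ℚ.+ f) ℚ.+ b ℚ.* (c ℚ.+ e)
        ≡ (a ℚ.* d ℚ.+ b ℚ.* c) ℚ.+ (a ℚ.* f ℚ.+ b ℚ.* e)
    imag = solve-∀ ℚ-acr

  *ᶜ-distribʳ : ∀ x y z → (y +ᶜ z) *ᶜ x ≈ᶜ y *ᶜ x +ᶜ z *ᶜ x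
  *ᶜ-distribʳ x y z = pointwiseᶜ
    (λ n → real (seq (re x) n) (seq (im x) n) (seq (re y) n) (seq (im y) n) (seq (re z) n) (seq (im z) n))
    (λ n → imag (seq (re x) n) (seq (im x) n) (seq (re y) n) (seq (im y) n) (seq (re z) n) (seq (im z) n))
    where
    real : ∀ a b c d e f →
      (c ℚ.+ e) ℚ.* a ℚ.+ ℚ.- ((d ℚ.+ f) ℚ.* b)
        ≡ (c ℚ.* a ℚ.+ ℚ.- (d ℚ.* b)) ℚ.+ (e ℚ.* a ℚ.+ ℚ.- (f ℚ.* b))
    real = solve-∀ ℚ-acr
    imag : ∀ a b c d e f →
      (c ℚ.+ e) ℚ.* b ℚ.+ (d ℚ.+ f) ℚ.* a
        ≡ (c ℚ.* b ℚ.+ d ℚ.* a) ℚ.+ (e ℚ.* b ℚ.+ f ℚ.* a)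
    imag = solve-∀ ℚ-acr

ℂ-commutativeRing : CommutativeRing 0ℓ 0ℓ
ℂ-commutativeRing = record
  { Carrier = ℂ
  ; _≈_     = _≈ᶜ_
  ; _+_     = _+ᶜ_
  ; _*_     = _*ᶜ_
  ; -_      = -ᶜ_
  ; 0#      = fromℚ 0ℚ
  ; 1#      = fromℚ 1ℚ
  ; isCommutativeRing = record
    { isRing = record
      { +-isAbelianGroup = record
        { isGroup = record
          { isMonoid = record
            { isSemigroup = record
              { isMagma = record
                { isEquivalence = ≈ᶜ-isEquivalence
                ; ∙-cong        = +ᶜ-cong
                }
              ; assoc = λ x y z → pointwiseᶜ
                  (λ n → ℚ.+-assoc (seq (re x) n) (seq (re y) n) (seq (re z) n))
                  (λ n → ℚ.+-assoc (seq (im x) n) (seq (im y) n) (seq (im z) n))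
              }
            ; identity = (λ x → pointwiseᶜ (λ n → ℚ.+-identityˡ (seq (re x) n)) (λ n → ℚ.+-identityˡ (seq (im x) n)))
                       , (λ x → pointwiseᶜ (λ n → ℚ.+-identityʳ (seq (re x) n)) (λ n → ℚ.+-identityʳ (seq (im x) n)))
            }
          ; inverse = (λ x → pointwiseᶜ (λ n → ℚ.+-inverseˡ (seq (re x) n)) (λ n → ℚ.+-inverseˡ (seq (im x) n)))
                    , (λ x → pointwiseᶜ (λ n → ℚ.+-inverseʳ (seq (re x) n)) (λ n → ℚ.+-inverseʳ (seq (im x) n)))
          ; ⁻¹-cong = -ᶜ-cong
          }
        ; comm = λ x y → pointwiseᶜ
            (λ n → ℚ.+-comm (seq (re x) n) (seq (re y) n))
            (λ n → ℚ.+-comm (seq (im x) n) (seq (im y) n))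
        }
      ; *-cong     = *ᶜ-cong
      ; *-assoc    = *ᶜ-assoc
      ; *-identity = *ᶜ-identityˡ , *ᶜ-identityʳ
      ; distrib    = *ᶜ-distribˡ , *ᶜ-distribʳ
      }
    ; *-comm = *ᶜ-comm
    }
  }

fromℚ-isRingHomomorphism :
  IsRingHomomorphism ℚ.+-*-rawRing (CommutativeRing.rawRing ℂ-commutativeRing) fromℚ
fromℚ-isRingHomomorphism = record
  { isSemiringHomomorphism = record
    { isNearSemiringHomomorphism = record
      { +-isMonoidHomomorphism = record
        { isMagmaHomomorphism = record
          { isRelHomomorphism = record
            { cong = λ { ≡.refl → CommutativeRing.refl ℂ-commutativeRing } }
          ; homo = λ p q → pointwiseᶜ (λ _ → ≡.refl) (λ _ → ≡.refl)
          }
        ; ε-homo = CommutativeRing.refl ℂ-commutativeRing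
        }
      ; *-homo = λ p q → pointwiseᶜ (λ _ → mul-re p q) (λ _ → mul-im p q)
      }
    ; 1#-homo = CommutativeRing.refl ℂ-commutativeRing
    }
  ; -‿homo = λ p → pointwiseᶜ (λ _ → ≡.refl) (λ _ → ≡.refl)
  }
  where
  mul-re : ∀ p q → p ℚ.* q ≡ p ℚ.* q ℚ.+ ℚ.- (0ℚ ℚ.* 0ℚ)
  mul-re p q = ≡.sym (ℚ.+-identityʳ (p ℚ.* q))
  mul-im : ∀ p q → 0ℚ ≡ p ℚ.* 0ℚ ℚ.+ 0ℚ ℚ.* q
  mul-im p q = ≡.sym (≡.cong₂ ℚ._+_ (ℚ.*-zeroʳ p) (ℚ.*-zeroˡ q))

-- Used below only for K = ℂ; ι makes K a ℚ-algebra, so that 1/k! makes sense.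
module PowerSeries {c ℓ} (K : CommutativeRing c ℓ)
  (ι : ℚ → CommutativeRing.Carrier K)
  (ι-isRingHomomorphism :
    IsRingHomomorphism ℚ.+-*-rawRing (CommutativeRing.rawRing K) ι)
  where

  open CommutativeRing K hiding (zero)
  open RawSemiringDefs (Semiring.rawSemiring semiring) using (_×_; _^_; sum)

  Matrix : ℕ → Set c
  Matrix n = Fin n → Fin n → Carrier

  minor : ∀ {n} → Matrix (suc n) → Fin (suc n) → Matrix n
  minor M j i k = M (suc i) (punchIn j k)

  -- Laplace expansion along the first row
  det : ∀ {n} → Matrix n → Carrier
  det {zero}  M = 1#
  det {suc n} M = sum λ j → (- 1#) ^ toℕ j * (M zero j * det (minor M j))

  -- f k is the coefficient of xᵏ, not of xᵏ/k!
  Series : Set c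
  Series = ℕ → Carrier

  infix  4 _≋_
  infixl 6 _⊕_
  infixl 7 _⊛_ _·_ _⊘_[_]

  _≋_ : Series → Series → Set ℓ
  f ≋ g = ∀ k → f k ≈ g k

  one : Series
  one zero    = 1#
  one (suc _) = 0#

  _⊕_ _⊛_ : Series → Series → Series
  (f ⊕ g) k = f k + g k
  (f ⊛ g) k = sum {suc k} λ i → f (toℕ i) * g (k ∸ toℕ i)

  _·_ : Carrier → Series → Series
  (s · f) k = s * f k

  -- The coefficients of 1/g of degrees n, …, 1, 0, in this order, when g has
  -- constant coefficient 1: the coefficient rₙ of xⁿ in 1/g is determined by
  -- rₙ₊₁ = -(g₁ rₙ + g₂ rₙ₋₁ + ⋯ + gₙ₊₁ r₀).
  recipCoeffs : Series → ∀ n → Vec Carrier (suc n)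
  recipCoeffs g zero    = 1# ∷ []
  recipCoeffs g (suc n) = - sum (λ i → g (suc (toℕ i)) * lookup rs i) ∷ rs
    where rs = recipCoeffs g n

  recip : Series → Series
  recip g n = head (recipCoeffs g n)

  _⊘_[_] : (f g : Series) → .(g 0 ≈ 1#) → Series
  f ⊘ g [ _ ] = f ⊛ recip g

  lookup-recipCoeffs : ∀ g n i → lookup (recipCoeffs g n) i ≡ recip g (n ∸ toℕ i)
  lookup-recipCoeffs g zero    zero    = ≡.refl
  lookup-recipCoeffs g (suc n) zero    = ≡.refl
  lookup-recipCoeffs g (suc n) (suc i) = lookup-recipCoeffs g n i

  private
    sum-cong : ∀ {n} {u v : Fin n → Carrier} → (∀ i → u i ≈ v i) → sum u ≈ sum v
    sum-cong {zero}  u≈v = refl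
    sum-cong {suc n} u≈v = +-cong (u≈v zero) (sum-cong (λ i → u≈v (suc i)))

  ⊛-recip : ∀ g → g 0 ≈ 1# → g ⊛ recip g ≋ one
  ⊛-recip g g₀≈1 zero = begin
    g 0 * 1# + 0#  ≈⟨ +-identityʳ _ ⟩
    g 0 * 1#       ≈⟨ *-identityʳ _ ⟩
    g 0            ≈⟨ g₀≈1 ⟩
    1#             ∎
    where open SetoidReasoning setoid
  ⊛-recip g g₀≈1 (suc n) = begin
    g 0 * (- S) + sum (λ (i : Fin (suc n)) → g (suc (toℕ i)) * recip g (n ∸ toℕ i))
      ≈⟨ +-cong (*-congʳ g₀≈1) (sum-cong λ i →
           *-congˡ {g (suc (toℕ i))} (reflexive (≡.sym (lookup-recipCoeffs g n i)))) ⟩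
    1# * (- S) + S  ≈⟨ +-congʳ (*-identityˡ (- S)) ⟩
    - S + S         ≈⟨ -‿inverseˡ S ⟩
    0#              ∎
    where
    open SetoidReasoning setoid
    S = sum (λ i → g (suc (toℕ i)) * lookup (recipCoeffs g n) i)

  -- The k-th derivatives at 0, so that sin = Σ sin⁽ k ⁾ xᵏ/k!
  sin⁽_⁾ cos⁽_⁾ : ℕ → Carrier
  sin⁽ 0 ⁾             = 0#
  sin⁽ 1 ⁾             = 1#
  sin⁽ suc (suc k) ⁾ = - sin⁽ k ⁾
  cos⁽ 0 ⁾             = 1#
  cos⁽ 1 ⁾             = 0#
  cos⁽ suc (suc k) ⁾ = - cos⁽ k ⁾

  1/_! : ℕ → Carrier
  1/ k ! = ι ((+ 1 ℚ./ (k !)) {{k ℕ.!≢0}})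

  sin cos : Series
  sin k = sin⁽ k ⁾ * 1/ k !
  cos k = cos⁽ k ⁾ * 1/ k !

  cos²₀≈1 : (cos ⊛ cos) 0 ≈ 1#
  cos²₀≈1 = begin
    (1# * ι 1ℚ) * (1# * ι 1ℚ) + 0#  ≈⟨ +-identityʳ _ ⟩
    (1# * ι 1ℚ) * (1# * ι 1ℚ)       ≈⟨ *-cong cos₀ cos₀ ⟩
    1# * 1#                         ≈⟨ *-identityˡ 1# ⟩
    1#                              ∎
    where
    open SetoidReasoning setoid
    cos₀ : 1# * ι 1ℚ ≈ 1#
    cos₀ = trans (*-identityˡ _) (IsRingHomomorphism.1#-homo ι-isRingHomomorphism)

  -- a_k, where f = Σ a_k xᵏ/k!
  egfCoeff : Series → ℕ → Carrier
  egfCoeff f k = (k !) × f k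

  Ḧ : ℕ → Series → Carrier
  Ḧ n f = det {n} λ i j → egfCoeff f (2 ℕ.* toℕ i ℕ.+ toℕ j)

  f[_] : Carrier → Series
  f[ s ] = ((sin ⊕ one) ⊘ (cos ⊛ cos) [ cos²₀≈1 ]) ⊕ (s · sin)

  ⟨sin³+1⟩/cos² : Series
  ⟨sin³+1⟩/cos² = ((sin ⊛ sin ⊛ sin) ⊕ one) ⊘ (cos ⊛ cos) [ cos²₀≈1 ]

  ⟦_⟧ : ℕ → Carrier
  ⟦ m ⟧ = m × 1#

-- (2k+1)!!
oddDoubleFactorial : ℕ → ℕ
oddDoubleFactorial k = product (applyUpTo (λ i → 2 ℕ.* i ℕ.+ 1) (suc k))

-- ∏_{k=1}^{n-1} (k!)² (2k+1)!!
hankelProduct : ℕ → ℕ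
hankelProduct n = product (applyUpTo (λ i → term (suc i)) (n ∸ 1))
  where
  term : ℕ → ℕ
  term k = (k !) ℕ.^ 2 ℕ.* oddDoubleFactorial k

module ℂ-Series = PowerSeries ℂ-commutativeRing fromℚ fromℚ-isRingHomomorphism

{-# OPTIONS --safe #-}
module Submission where

-- Put y = (sin x + 1)/cos² x = 1/(1 - sin x), so that f_s = y + s sin x. As
-- (D² + m²) yᵐ = m (2m + 1) yᵐ⁺¹ and (D² + 1) sin = 0, replacing D²ⁱ by
-- (D² + 1²)(D² + 2²) ⋯ (D² + i²), which is a unitriangular row operation, turns the
-- rows D²ⁱ f_s of the Hankel matrix into f_s and i! (2i+1)!! yⁱ⁺¹ for i ≥ 1. With
-- w = y - 1 = y sin x = x + ⋯, a second such operation turns y², …, yⁿ into the upper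
-- triangular family y² wⁱ for i < n - 1. Modulo these, f_s = y + s (1 - 1/y) reduces
-- to its term of order w ^ (n - 1), whose coefficient is (-1)ⁿ⁻¹ (1 - s (n choose 2)).

open import Defs
open import Algebra.Bundles using (CommutativeRing; Semiring)
import Algebra.Definitions.RawSemiring as RawSemiringDefs
import Algebra.Morphism.Construct.Composition as Composition
open import Algebra.Morphism.Structures using (IsRingHomomorphism)
import Algebra.Properties.CommutativeMonoid.Mult as CommutativeMonoidMult
import Algebra.Properties.Ring as RingProperties
import Algebra.Properties.Semiring.Mult as SemiringMult
import Algebra.Properties.Semiring.Sum as SemiringSum
import Algebra.Solver.Ring as RingSolver
open import Algebra.Solver.Ring.AlmostCommutativeRing
  using (_-Raw-AlmostCommutative⟶_; Induced-equivalence; fromCommutativeRing)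
open import Data.Bool.Base using (if_then_else_)
open import Data.Fin.Base using (Fin; zero; suc; toℕ; punchIn)
open import Data.Integer.Base as ℤ using (+_)
import Data.Integer.Properties as ℤ
open import Data.List.Base using (applyUpTo; _∷ʳ_)
open import Data.List.Properties using (applyUpTo-∷ʳ)
open import Data.Maybe.Base as Maybe using ()
open import Data.Nat.Base as ℕ using (ℕ; zero; suc; _!)
open import Data.Nat.Combinatorics using (_C_; nC1≡n; nCk+nC[k+1]≡[n+1]C[k+1])
open import Data.Nat.ListAction using (product)
open import Data.Nat.ListAction.Properties using (product-++)
import Data.Nat.Properties as ℕ
open import Data.Nat.Tactic.RingSolver using (solve-∀)
open import Data.Product.Base as Product using (_,_; proj₁; proj₂)
open import Data.Rational.Base as ℚ using (ℚ; 0ℚ; 1ℚ)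
import Data.Rational.Properties as ℚ
open import Data.Rational.Unnormalised.Base as ℚᵘ using (mkℚᵘ; *≡*)
import Data.Rational.Unnormalised.Properties as ℚᵘ
open import Data.Unit.Polymorphic.Base using (⊤)
open import Data.Vec.Functional using (Vector; _∷_)
open import Function.Base using (_∘_)
open import Relation.Binary.Definitions using (WeaklyDecidable)
import Relation.Binary.Reasoning.Setoid as SetoidReasoning
open import Relation.Binary.PropositionalEquality as ≡ using (_≡_; _≗_)
open import Relation.Nullary.Decidable.Core using (does; yes; no; dec⇒maybe)

-- Both row operations are instances of one principle: for a linear operator `T`, the rows
-- `v, T v, T² v, …` may be replaced by `pₖ(T) v` with `pₖ` monic of degree `k`. The operator is
-- `D²` at first and multiplication by `y` later, where `pₖ(T) = (T - 1)ᵏ` is multiplication by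
-- `wᵏ`. The determinant is given only as Laplace expansion along the first row. Row operations are
-- therefore arranged to touch just the two top rows, alternation is established for these, and
-- induction inside the cofactors reaches the deeper rows. The binomial comes from the coefficient
-- of `wᵏ` in `1/y + s (1/y² - 1/y³)` for `y = 1 + w`, which is `(-1)ᵏ (1 + s ((k+1) - (k+2 choose
-- 2))) = (-1)ᵏ (1 - s (k+1 choose 2))`. Its sign is absorbed by the `n -
-- 1` row exchanges that bring the row of `f_s` to the bottom, where it completes a triangular
-- matrix.

module RationalAlgebraSolver {c ℓ} (K : CommutativeRing c ℓ)
  (ι : ℚ → CommutativeRing.Carrier K)
  (ι-isRingHomomorphism :
    IsRingHomomorphism ℚ.+-*-rawRing (CommutativeRing.rawRing K) ι)
  where

  open CommutativeRing K
  open IsRingHomomorphism ι-isRingHomomorphism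

  -- Equal to ι up to ≈, but the solver's constants 0 and 1 become literally 0# and 1#.
  coefficient : ℚ → Carrier
  coefficient q = if does (q ℚ.≟ 0ℚ) then 0# else if does (q ℚ.≟ 1ℚ) then 1# else ι q

  coefficient≈ι : ∀ q → coefficient q ≈ ι q
  coefficient≈ι q with q ℚ.≟ 0ℚ
  ... | yes ≡.refl = sym 0#-homo
  ... | no  _ with q ℚ.≟ 1ℚ
  ...   | yes ≡.refl = sym 1#-homo
  ...   | no  _      = refl

  coefficient-morphism : ℚ.+-*-rawRing -Raw-AlmostCommutative⟶ fromCommutativeRing K
  coefficient-morphism = record
    { ⟦_⟧    = coefficient
    ; +-homo = λ p q → trans (coefficient≈ι (p ℚ.+ q))
        (trans (+-homo p q) (sym (+-cong (coefficient≈ι p) (coefficient≈ι q))))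
    ; *-homo = λ p q → trans (coefficient≈ι (p ℚ.* q))
        (trans (*-homo p q) (sym (*-cong (coefficient≈ι p) (coefficient≈ι q))))
    ; -‿homo = λ p → trans (coefficient≈ι (ℚ.- p))
        (trans (-‿homo p) (sym (-‿cong (coefficient≈ι p))))
    ; 0-homo = refl
    ; 1-homo = refl
    }

  coefficient≟ : WeaklyDecidable (Induced-equivalence coefficient-morphism)
  coefficient≟ p q =
    Maybe.map (λ p≡q → reflexive (≡.cong coefficient p≡q)) (dec⇒maybe (p ℚ.≟ q))

  open RingSolver ℚ.+-*-rawRing (fromCommutativeRing K) coefficient-morphism coefficient≟
    public using (solve; _:=_; _:+_; _:*_; _:-_; :-_; con)

-- Row operations on determinants defined by Laplace expansion.

module Determinants {c ℓ} (K : CommutativeRing c ℓ)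
  (ι : ℚ → CommutativeRing.Carrier K)
  (ι-isRingHomomorphism :
    IsRingHomomorphism ℚ.+-*-rawRing (CommutativeRing.rawRing K) ι)
  where

  open CommutativeRing K hiding (zero)
  open PowerSeries K ι ι-isRingHomomorphism using (Matrix; minor; det)
  open RawSemiringDefs (Semiring.rawSemiring semiring) using (_^_)
  open RingProperties ring using (-‿involutive; +-inverseˡ-unique; -‿distribˡ-*)
  open SemiringSum semiring
    using (sum; sum-cong-≋; sum-replicate-zero; ∑-distrib-+; *-distribˡ-sum)
  open RationalAlgebraSolver K ι ι-isRingHomomorphism
  open SetoidReasoning setoid

  sgn : ∀ {n} → Fin n → Carrier
  sgn j = (- 1#) ^ toℕ j

  sgn-suc : ∀ {n} (j : Fin n) → sgn (suc j) ≈ - sgn j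
  sgn-suc j = trans (sym (-‿distribˡ-* 1# (sgn j))) (-‿cong (*-identityˡ (sgn j)))

  sum-zero : ∀ {n} {t : Vector Carrier n} → (∀ i → t i ≈ 0#) → sum t ≈ 0#
  sum-zero {n} t≈0 = trans (sum-cong-≋ t≈0) (sum-replicate-zero n)

  sum-neg : ∀ {n} (t : Vector Carrier n) → sum (λ i → - t i) ≈ - sum t
  sum-neg t = +-inverseˡ-unique _ _ (begin
    sum (λ i → - t i) + sum t  ≈⟨ ∑-distrib-+ (λ i → - t i) t ⟨
    sum (λ i → - t i + t i)    ≈⟨ sum-zero (λ i → -‿inverseˡ (t i)) ⟩
    0#                         ∎)

  cofactor : ∀ {n} → (Fin n → Vector Carrier (suc n)) → Vector Carrier (suc n)
  cofactor N j = det (λ i k → N i (punchIn j k))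

  -- By definition the determinant with first row `v` and further rows `N`. As separate arguments,
  -- the first row, and the second one in `w ∷ N`, can be varied without updating a matrix.
  expand : ∀ {n} → Vector Carrier (suc n) → (Fin n → Vector Carrier (suc n)) → Carrier
  expand v N = sum λ j → sgn j * (v j * cofactor N j)

  det-cong : ∀ {n} {M N : Matrix n} → (∀ i j → M i j ≈ N i j) → det M ≈ det N
  det-cong {zero}  M≈N = refl
  det-cong {suc n} M≈N = sum-cong-≋ λ j → *-congˡ {sgn j} (*-cong (M≈N zero j)
    (det-cong λ i k → M≈N (suc i) (punchIn j k)))

  expand-congʳ : ∀ {n} v (M N : Fin n → Vector Carrier (suc n)) →
    (∀ j → cofactor M j ≈ cofactor N j) →
    expand v M ≈ expand v N
  expand-congʳ v M N M≈N = sum-cong-≋ λ j → *-congˡ {sgn j} (*-congˡ {v j} (M≈N j))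

  expand-congˡ : ∀ {n} {u v} (N : Fin n → Vector Carrier (suc n)) →
    (∀ j → u j ≈ v j) → expand u N ≈ expand v N
  expand-congˡ N u≈v = sum-cong-≋ λ j → *-congˡ {sgn j} (*-congʳ {cofactor N j} (u≈v j))

  expand-neg : ∀ {n} v (N : Fin n → Vector Carrier (suc n)) →
    expand (λ j → - v j) N ≈ - expand v N
  expand-neg v N = trans
    (sum-cong-≋ λ j → solve 3 (λ s a d → s :* (:- a :* d) := :- (s :* (a :* d))) refl
      (sgn j) (v j) (cofactor N j))
    (sum-neg λ j → sgn j * (v j * cofactor N j))

  expand-linear : ∀ {n} a (u v : Vector Carrier (suc n)) N →
    expand (λ k → a * u k + v k) N ≈ a * expand u N + expand v N
  expand-linear a u v N = begin
    expand (λ k → a * u k + v k) N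
      ≈⟨ sum-cong-≋ (λ j → rearrange a (sgn j) (u j) (v j) (cofactor N j)) ⟩
    sum (λ j → a * term u j + term v j)
      ≈⟨ ∑-distrib-+ (λ j → a * term u j) (term v) ⟩
    sum (λ j → a * term u j) + expand v N
      ≈⟨ +-congʳ (*-distribˡ-sum a (term u)) ⟨
    a * expand u N + expand v N  ∎
    where
    term : Vector Carrier _ → Vector Carrier _
    term w j = sgn j * (w j * cofactor N j)
    rearrange : ∀ a s u v d → s * ((a * u + v) * d) ≈ a * (s * (u * d)) + s * (v * d)
    rearrange = solve 5 (λ a s u v d → s :* ((a :* u :+ v) :* d)
      := a :* (s :* (u :* d)) :+ s :* (v :* d)) refl

  expand-linear₁ : ∀ {n} a (u v w : Vector Carrier (suc (suc n))) N →
    expand u ((λ k → a * v k + w k) ∷ N) ≈ a * expand u (v ∷ N) + expand u (w ∷ N)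
  expand-linear₁ a u v w N = begin
    expand u ((λ k → a * v k + w k) ∷ N)
      ≈⟨ sum-cong-≋ (λ j → trans
           (*-congˡ {sgn j} (*-congˡ {u j}
             (expand-linear a (λ k → v (punchIn j k)) (λ k → w (punchIn j k))
                            (λ i k → N i (punchIn j k)))))
           (rearrange a (sgn j) (u j) (cofactor (v ∷ N) j) (cofactor (w ∷ N) j))) ⟩
    sum (λ j → a * term v j + term w j)
      ≈⟨ ∑-distrib-+ (λ j → a * term v j) (term w) ⟩
    sum (λ j → a * term v j) + expand u (w ∷ N)
      ≈⟨ +-congʳ (*-distribˡ-sum a (term v)) ⟨
    a * expand u (v ∷ N) + expand u (w ∷ N)  ∎
    where
    term : Vector Carrier _ → Vector Carrier _
    term x j = sgn j * (u j * cofactor (x ∷ N) j)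
    rearrange : ∀ a s u d e → s * (u * (a * d + e)) ≈ a * (s * (u * d)) + s * (u * e)
    rearrange = solve 5 (λ a s u d e → s :* (u :* (a :* d :+ e))
      := a :* (s :* (u :* d)) :+ s :* (u :* e)) refl

  -- G j k stands for a function of the ordered pair of distinct columns j and
  -- punchIn j k; the predicate says that it is symmetric in these.
  Symmetric : ∀ n → (Fin (suc n) → Fin n → Carrier) → Set ℓ
  Symmetric zero    G = ⊤
  Symmetric (suc n) G =
    (∀ k → G zero k ≈ G (suc k) zero) Product.× Symmetric n (λ j k → G (suc j) (suc k))

  symmetric-resp : ∀ n (G H : Fin (suc n) → Fin n → Carrier) →
    (∀ j k → G j k ≈ H j k) → Symmetric n G → Symmetric n H
  symmetric-resp zero    G H G≈H _       = _
  symmetric-resp (suc n) G H G≈H (p , q) =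
    (λ k → trans (sym (G≈H zero k)) (trans (p k) (G≈H (suc k) zero))) ,
    symmetric-resp n (λ j k → G (suc j) (suc k)) (λ j k → H (suc j) (suc k))
      (λ j k → G≈H (suc j) (suc k)) q

  -- Deleting two columns in either order leaves the same columns in the same order. The induction
  -- carries column `zero` along in the third argument of `Φ`; the congruence hypothesis on `Φ`
  -- replaces function extensionality, as the families of remaining columns agree only pointwise.
  symmetric-columns : ∀ n {A : Set c} (e : Fin (suc (suc n)) → A)
    (Φ : A → A → (Fin n → A) → Carrier) →
    (∀ a b g → Φ a b g ≈ Φ b a g) → (∀ a b g h → g ≗ h → Φ a b g ≈ Φ a b h) →
    Symmetric (suc n) λ j k →
      Φ (e j) (e (punchIn j k)) (λ l → e (punchIn j (punchIn k l)))
  symmetric-columns zero    e Φ Φ-sym Φ-cong =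
    (λ k → Φ-sym (e zero) (e (suc k)) (λ l → e (suc (punchIn k l)))) , _
  symmetric-columns (suc n) e Φ Φ-sym Φ-cong =
    (λ k → Φ-sym (e zero) (e (suc k)) (λ l → e (suc (punchIn k l)))) ,
    symmetric-resp (suc n) _ (λ j k → G (suc j) (suc k))
      (λ j k → Φ-cong (e (suc j)) (e (suc (punchIn j k)))
        (e zero ∷ λ l → e (suc (punchIn j (punchIn k l))))
        (λ l → e (punchIn (suc j) (punchIn (suc k) l)))
        λ { zero → ≡.refl ; (suc _) → ≡.refl })
      (symmetric-columns n (λ i → e (suc i)) (λ a b g → Φ a b (e zero ∷ g))
        (λ a b g → Φ-sym a b (e zero ∷ g))
        (λ a b g h g≗h → Φ-cong a b (e zero ∷ g) (e zero ∷ h) λ { zero → ≡.refl ; (suc l) → g≗h l }))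
    where
    G : Fin (suc (suc (suc n))) → Fin (suc (suc n)) → Carrier
    G j k = Φ (e j) (e (punchIn j k)) (λ l → e (punchIn j (punchIn k l)))

  -- The pairs `(zero , k)` and `(suc k , zero)` have equal values and opposite signs, so they
  -- cancel. The other pairs form a smaller instance, since shifting both indices changes the sign
  -- twice.
  symmetric-sum : ∀ n (G : Fin (suc n) → Fin n → Carrier) → Symmetric n G →
    sum (λ j → sgn j * sum (λ k → sgn k * G j k)) ≈ 0#
  symmetric-sum zero    G _       = sum-zero {1} λ j → zeroʳ (sgn j)
  symmetric-sum (suc n) G (p , q) = begin
    1# * sum first + sum (λ j → sgn (suc j) * (1# * G (suc j) zero + inner j))
      ≈⟨ +-cong (*-identityˡ (sum first)) (sum-cong-≋ split) ⟩
    sum first + sum (λ j → - first j + rest j)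
      ≈⟨ +-congˡ (∑-distrib-+ (λ j → - first j) rest) ⟩
    sum first + (sum (λ j → - first j) + sum rest)
      ≈⟨ +-congˡ (+-cong (sum-neg first) (symmetric-sum n (λ j k → G (suc j) (suc k)) q)) ⟩
    sum first + (- sum first + 0#)
      ≈⟨ +-congˡ (+-identityʳ (- sum first)) ⟩
    sum first + - sum first
      ≈⟨ -‿inverseʳ (sum first) ⟩
    0#  ∎
    where
    first : Vector Carrier (suc n)
    first k = sgn k * G zero k
    term : Fin (suc n) → Vector Carrier n
    term j k = sgn k * G (suc j) (suc k)
    rest inner : Vector Carrier (suc n)
    rest j = sgn j * sum (term j)
    inner j = sum (λ k → sgn (suc k) * G (suc j) (suc k))
    inner≈ : ∀ j → inner j ≈ - sum (term j)
    inner≈ j = trans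
      (sum-cong-≋ {n} λ k → trans (*-congʳ {G (suc j) (suc k)} (sgn-suc k))
        (sym (-‿distribˡ-* (sgn k) _)))
      (sum-neg (term j))
    split : ∀ j → sgn (suc j) * (1# * G (suc j) zero + inner j) ≈ - first j + rest j
    split j = trans
      (*-cong (sgn-suc j) (+-cong (*-congˡ {1#} (sym (p j))) (inner≈ j)))
      (solve 3 (λ s a b → :- s :* (con 1ℚ :* a :+ :- b) := :- (s :* a) :+ s :* b) refl
        (sgn j) (G zero j) (sum (term j)))

  -- Expansion along both equal rows is a signed sum over ordered pairs of distinct columns, and its
  -- summand, two entries of `v` times a minor of `N`, is symmetric in the pair.
  expand-alternating : ∀ {n} v (N : Fin n → Vector Carrier (suc (suc n))) →
    expand v (v ∷ N) ≈ 0#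
  expand-alternating {n} v N = begin
    expand v (v ∷ N)
      ≈⟨ sum-cong-≋ (λ j → *-congˡ {sgn j} (trans (*-distribˡ-sum (v j) (λ k → sgn k * rest j k))
           (sum-cong-≋ λ k → swap (v j) (sgn k) (rest j k)))) ⟩
    sum (λ j → sgn j * sum (λ k → sgn k * (v j * rest j k)))
      ≈⟨ symmetric-sum (suc n) (λ j k → v j * rest j k) (symmetric-columns n col Φ Φ-sym Φ-cong) ⟩
    0#  ∎
    where
    rest : Fin (suc (suc n)) → Fin (suc n) → Carrier
    rest j k = v (punchIn j k) * det (λ i l → N i (punchIn j (punchIn k l)))
    swap : ∀ a s d → a * (s * d) ≈ s * (a * d)
    swap = solve 3 (λ a s d → a :* (s :* d) := s :* (a :* d)) refl
    -- A column stores the entry shared by the two equal rows, followed by its entries in `N`.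
    col : Fin (suc (suc n)) → Vector Carrier (suc n)
    col j = v j ∷ λ i → N i j
    Φ : Vector Carrier (suc n) → Vector Carrier (suc n) →
        (Fin n → Vector Carrier (suc n)) → Carrier
    Φ a b g = a zero * (b zero * det (λ i l → g l (suc i)))
    Φ-sym : ∀ a b g → Φ a b g ≈ Φ b a g
    Φ-sym a b g = swap (a zero) (b zero) _
    Φ-cong : ∀ a b g h → g ≗ h → Φ a b g ≈ Φ a b h
    Φ-cong a b g h g≗h = *-congˡ {a zero} (*-congˡ {b zero}
      (det-cong λ i l → reflexive (≡.cong (λ x → x (suc i)) (g≗h l))))

  -- Polarisation of `expand-alternating` at the row `v + w`.
  expand-swap : ∀ {n} v w (N : Fin n → Vector Carrier (suc (suc n))) →
    expand v (w ∷ N) ≈ - expand w (v ∷ N)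
  expand-swap v w N = +-inverseˡ-unique _ _ (begin
    expand v (w ∷ N) + expand w (v ∷ N)
      ≈⟨ fill (expand v (w ∷ N)) (expand w (v ∷ N)) ⟨
    1# * (1# * 0# + expand v (w ∷ N)) + (1# * expand w (v ∷ N) + 0#)
      ≈⟨ +-cong (*-congˡ (+-congʳ (*-congˡ (expand-alternating v N))))
                (+-congˡ (expand-alternating w N)) ⟨
    1# * (1# * expand v (v ∷ N) + expand v (w ∷ N)) + (1# * expand w (v ∷ N) + expand w (w ∷ N))
      ≈⟨ +-cong (*-congˡ (expand-linear₁ 1# v v w N)) (expand-linear₁ 1# w v w N) ⟨
    1# * expand v (v+w ∷ N) + expand w (v+w ∷ N)
      ≈⟨ expand-linear 1# v w (v+w ∷ N) ⟨
    expand v+w (v+w ∷ N)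
      ≈⟨ expand-alternating v+w N ⟩
    0#  ∎)
    where
    v+w : Vector Carrier _
    v+w k = 1# * v k + w k
    fill : ∀ a b → 1# * (1# * 0# + a) + (1# * b + 0#) ≈ a + b
    fill a b = +-cong
      (trans (*-identityˡ _) (trans (+-congʳ (*-identityˡ 0#)) (+-identityˡ a)))
      (trans (+-identityʳ _) (*-identityˡ b))

  -- The multiple of `R 0` in the second row drops out by alternation. The cofactors of the first
  -- row then have the same bidiagonal shape, with `R` shifted by one.
  det-bidiagonal : ∀ n α (R : ℕ → Vector Carrier (suc n)) →
    expand (R 0) (λ i k → α * R (toℕ i) k + R (suc (toℕ i)) k) ≈ det (λ i → R (toℕ i))
  det-bidiagonal zero    α R = refl
  det-bidiagonal (suc n) α R = begin
    expand (R 0) B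
      ≈⟨ expand-congʳ (R 0) B ((λ k → α * R 0 k + R 1 k) ∷ N) (λ _ → refl) ⟩
    expand (R 0) ((λ k → α * R 0 k + R 1 k) ∷ N)
      ≈⟨ expand-linear₁ α (R 0) (R 0) (R 1) N ⟩
    α * expand (R 0) (R 0 ∷ N) + expand (R 0) (R 1 ∷ N)
      ≈⟨ +-congʳ (trans (*-congˡ (expand-alternating (R 0) N)) (zeroʳ α)) ⟩
    0# + expand (R 0) (R 1 ∷ N)
      ≈⟨ +-identityˡ _ ⟩
    expand (R 0) (R 1 ∷ N)
      ≈⟨ expand-congʳ (R 0) (R 1 ∷ N) (λ i → R (suc (toℕ i)))
           (λ j → det-bidiagonal n α (λ i k → R (suc i) (punchIn j k))) ⟩
    det (λ i → R (toℕ i))  ∎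
    where
    B : Fin (suc n) → Vector Carrier (suc (suc n))
    B i k = α * R (toℕ i) k + R (suc (toℕ i)) k
    N : Fin n → Vector Carrier (suc (suc n))
    N i k = α * R (suc (toℕ i)) k + R (suc (suc (toℕ i))) k

  -- R k i is to be thought of as p_k(T) Tⁱ v with p_k = (T + α₀) ⋯ (T + αₖ₋₁).
  det-newton : ∀ n (α : ℕ → Carrier) (R : ℕ → ℕ → Vector Carrier n) →
    (∀ k i j → R (suc k) i j ≈ α k * R k i j + R k (suc i) j) →
    det (λ i → R 0 (toℕ i)) ≈ det (λ i → R (toℕ i) 0)
  det-newton zero    α R step = refl
  det-newton (suc n) α R step = begin
    det (λ i → R 0 (toℕ i))
      ≈⟨ det-bidiagonal n (α 0) (R 0) ⟨
    expand (R 0 0) B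
      ≈⟨ expand-congʳ (R 0 0) (λ i → R 1 (toℕ i)) B
           (λ j → det-cong λ i k → step 0 (toℕ i) (punchIn j k)) ⟨
    -- Row 0 is now final; the induction runs inside its cofactors, with `α` shifted.
    expand (R 0 0) (λ i → R 1 (toℕ i))
      ≈⟨ expand-congʳ (R 0 0) (λ i → R 1 (toℕ i)) (λ i → R (suc (toℕ i)) 0)
           (λ j → det-newton n (λ k → α (suc k))
           (λ k i l → R (suc k) i (punchIn j l))
           (λ k i l → step (suc k) i (punchIn j l))) ⟩
    det (λ i → R (toℕ i) 0)  ∎
    where
    B : Fin n → Vector Carrier (suc n)
    B i k = α 0 * R 0 (toℕ i) k + R 0 (suc (toℕ i)) k

  ∏ : ℕ → (ℕ → Carrier) → Carrier
  ∏ zero    a = 1#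
  ∏ (suc n) a = a 0 * ∏ n (λ i → a (suc i))

  det-scaleRows : ∀ {n} (a : ℕ → Carrier) (M : Matrix n) →
    det (λ i j → a (toℕ i) * M i j) ≈ ∏ n a * det M
  det-scaleRows {zero}  a M = sym (*-identityˡ 1#)
  det-scaleRows {suc n} a M = begin
    sum (λ j → sgn j * (a 0 * M zero j * det (λ i k → a (suc (toℕ i)) * minor M j i k)))
      ≈⟨ sum-cong-≋ (λ j → trans
           (*-congˡ {sgn j} (*-congˡ (det-scaleRows (λ i → a (suc i)) (minor M j))))
           (regroup (sgn j) (a 0) (M zero j) _ _)) ⟩
    sum (λ j → ∏ (suc n) a * (sgn j * (M zero j * det (minor M j))))
      ≈⟨ *-distribˡ-sum (∏ (suc n) a) (λ j → sgn j * (M zero j * det (minor M j))) ⟨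
    ∏ (suc n) a * det M  ∎
    where
    regroup : ∀ s a m p d → s * (a * m * (p * d)) ≈ a * p * (s * (m * d))
    regroup = solve 5 (λ s a m p d → s :* (a :* m :* (p :* d)) := a :* p :* (s :* (m :* d))) refl

  det-zeroColumn : ∀ {n} (M : Matrix (suc n)) → (∀ i → M i zero ≈ 0#) → det M ≈ 0#
  -- Deleting any column but the first keeps the zero column, so only the first cofactor survives.
  -- The two lemmas are mutual because expansion is along rows.
  expand-zeroColumn : ∀ {n} v (N : Fin n → Vector Carrier (suc n)) →
    (∀ i → N i zero ≈ 0#) → expand v N ≈ v zero * det (λ i k → N i (suc k))

  det-zeroColumn M M₀≈0 = begin
    det M                              ≈⟨ expand-zeroColumn (M zero) (λ i → M (suc i))
                                            (λ i → M₀≈0 (suc i)) ⟩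
    M zero zero * D                    ≈⟨ *-congʳ {D} (M₀≈0 zero) ⟩
    0# * D                             ≈⟨ zeroˡ D ⟩
    0#                                 ∎
    where D = det (λ i k → M (suc i) (suc k))
  expand-zeroColumn {zero}  v N N₀≈0 = trans (+-identityʳ _) (*-identityˡ _)
  expand-zeroColumn {suc n} v N N₀≈0 = begin
    1# * (v zero * D) + sum (λ j → sgn (suc j) * (v (suc j) * cofactor N (suc j)))
      ≈⟨ +-cong (*-identityˡ _) (sum-zero λ j → trans
           (*-congˡ {sgn (suc j)} (trans (*-congˡ {v (suc j)}
             (det-zeroColumn (λ i k → N i (punchIn (suc j) k)) N₀≈0)) (zeroʳ _)))
           (zeroʳ _)) ⟩
    v zero * D + 0#
      ≈⟨ +-identityʳ _ ⟩
    v zero * D  ∎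
    where
    D = det (λ i k → N i (suc k))

  -- If both A and G are upper triangular and Gₖ + Gₖ₊₁ is a multiple of Aₖ, then
  -- G₀ may be moved past A₀, …, Aₘ₋₁, whereby it turns into Gₘ.
  det-prepend : ∀ m (A G : ℕ → ℕ → Carrier) (h : ℕ → Carrier) →
    (∀ k j → G k j ≈ h k * A k j + - G (suc k) j) →
    (∀ k j → j ℕ.< k → A k j ≈ 0#) → (∀ k j → j ℕ.< k → G k j ≈ 0#) →
    expand (λ j → G 0 (toℕ j)) (λ (i : Fin m) j → A (toℕ i) (toℕ j))
      ≈ ∏ m (λ k → A k k) * G m m
  det-prepend zero    A G h step A-upper G-upper =
    trans (+-identityʳ _) (trans (*-identityˡ _)
      (trans (*-identityʳ _) (sym (*-identityˡ _))))
  det-prepend (suc m) A G h step A-upper G-upper = begin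
    expand G₀ (A₀ ∷ N)
      ≈⟨ expand-congˡ (A₀ ∷ N) (λ j → step 0 (toℕ j)) ⟩
    expand (λ j → h 0 * A₀ j + - G₁ j) (A₀ ∷ N)
      ≈⟨ expand-linear (h 0) A₀ (λ j → - G₁ j) (A₀ ∷ N) ⟩
    h 0 * expand A₀ (A₀ ∷ N) + expand (λ j → - G₁ j) (A₀ ∷ N)
      -- The minus sign of `step` meets that of the row exchange, so no sign accumulates.
      ≈⟨ +-cong (trans (*-congˡ (expand-alternating A₀ N)) (zeroʳ _))
                (trans (expand-neg G₁ (A₀ ∷ N)) (-‿cong (expand-swap G₁ A₀ N))) ⟩
    0# + - - expand A₀ (G₁ ∷ N)
      ≈⟨ trans (+-identityˡ _) (-‿involutive _) ⟩
    expand A₀ (G₁ ∷ N)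
      -- With `A₀` on top, triangularity clears the first column below it, and row and column 0
      -- split off.
      ≈⟨ expand-zeroColumn A₀ (G₁ ∷ N) (λ
           { zero    → G-upper 1 0 (ℕ.s≤s ℕ.z≤n)
           ; (suc i) → A-upper (suc (toℕ i)) 0 (ℕ.s≤s ℕ.z≤n) }) ⟩
    A 0 0 * expand (λ j → G 1 (suc (toℕ j))) (λ (i : Fin m) j → A (suc (toℕ i)) (suc (toℕ j)))
      ≈⟨ *-congˡ (det-prepend m (λ k j → A (suc k) (suc j)) (λ k j → G (suc k) (suc j))
           (λ k → h (suc k)) (λ k j → step (suc k) (suc j))
           (λ k j j<k → A-upper (suc k) (suc j) (ℕ.s≤s j<k))
           (λ k j j<k → G-upper (suc k) (suc j) (ℕ.s≤s j<k))) ⟩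
    A 0 0 * (∏ m (λ k → A (suc k) (suc k)) * G (suc m) (suc m))
      ≈⟨ *-assoc _ _ _ ⟨
    ∏ (suc m) (λ k → A k k) * G (suc m) (suc m)  ∎
    where
    G₀ G₁ A₀ : Vector Carrier (suc (suc m))
    G₀ j = G 0 (toℕ j)
    G₁ j = G 1 (toℕ j)
    A₀ j = A 0 (toℕ j)
    N : Fin m → Vector Carrier (suc (suc m))
    N i j = A (suc (toℕ i)) (toℕ j)

-- The ring of formal power series and its derivation.

module SeriesRing {c ℓ} (K : CommutativeRing c ℓ)
  (ι : ℚ → CommutativeRing.Carrier K)
  (ι-isRingHomomorphism :
    IsRingHomomorphism ℚ.+-*-rawRing (CommutativeRing.rawRing K) ι)
  where

  open CommutativeRing K hiding (zero)
  open PowerSeries K ι ι-isRingHomomorphism using (Series; _≋_; one; _⊕_; _⊛_; _·_)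
  open RingProperties ring using (-0#≈0#)
  open RawSemiringDefs (Semiring.rawSemiring semiring) using (_×_)
  open SemiringMult semiring using (×-congʳ; ×-comm-*; ×-assoc-*)
  open CommutativeMonoidMult +-commutativeMonoid using (×-distrib-+)
  open RationalAlgebraSolver K ι ι-isRingHomomorphism
  open SetoidReasoning setoid

  -- By definition `(f ⊛ g) (suc k)` is `f 0 * g (suc k) + (tail f ⊛ g) k`; the inductions on the
  -- degree below rest on this.
  tail : Series → Series
  tail f k = f (suc k)

  const : Carrier → Series
  const a zero    = a
  const a (suc _) = 0#

  ⊛-cong : ∀ {f f′ g g′} → f ≋ f′ → g ≋ g′ → f ⊛ g ≋ f′ ⊛ g′
  ⊛-cong p q zero    = +-congʳ (*-cong (p 0) (q 0))
  ⊛-cong {f} {f′} p q (suc k) = +-cong (*-cong (p 0) (q (suc k)))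
    (⊛-cong {tail f} {tail f′} (λ i → p (suc i)) q k)

  ⊛-distribʳ : ∀ h f g → (f ⊕ g) ⊛ h ≋ (f ⊛ h) ⊕ (g ⊛ h)
  ⊛-distribʳ h f g zero = solve 3 (λ f g h → (f :+ g) :* h :+ con 0ℚ
    := (f :* h :+ con 0ℚ) :+ (g :* h :+ con 0ℚ)) refl (f 0) (g 0) (h 0)
  ⊛-distribʳ h f g (suc k) = trans (+-congˡ (⊛-distribʳ h (tail f) (tail g) k))
    (solve 5 (λ f g h a b → (f :+ g) :* h :+ (a :+ b) := (f :* h :+ a) :+ (g :* h :+ b)) refl
      (f 0) (g 0) (h (suc k)) ((tail f ⊛ h) k) ((tail g ⊛ h) k))

  ·-⊛-assoc : ∀ a f g → (a · f) ⊛ g ≋ a · (f ⊛ g)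
  ·-⊛-assoc a f g zero = solve 3 (λ a f g → a :* f :* g :+ con 0ℚ := a :* (f :* g :+ con 0ℚ))
    refl a (f 0) (g 0)
  ·-⊛-assoc a f g (suc k) = trans (+-congˡ (·-⊛-assoc a (tail f) g k))
    (solve 4 (λ a f g h → a :* f :* g :+ a :* h := a :* (f :* g :+ h)) refl
      a (f 0) (g (suc k)) ((tail f ⊛ g) k))

  ⊛-vanish : ∀ f g n → (∀ k → k ℕ.≤ n → g k ≈ 0#) → (f ⊛ g) n ≈ 0#
  ⊛-vanish f g zero    g≈0 = trans (+-identityʳ _) (trans (*-congˡ (g≈0 0 ℕ.z≤n)) (zeroʳ _))
  ⊛-vanish f g (suc n) g≈0 = trans
    (+-cong (trans (*-congˡ (g≈0 (suc n) ℕ.≤-refl)) (zeroʳ _))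
            (⊛-vanish (tail f) g n (λ k k≤n → g≈0 k (ℕ.m≤n⇒m≤1+n k≤n))))
    (+-identityʳ _)

  -- The mirror image of the defining recursion, splitting off the constant term of the right
  -- factor. Commutativity and the product rule need both forms.
  ⊛-tailʳ : ∀ f g k → (f ⊛ g) (suc k) ≈ (f ⊛ tail g) k + f (suc k) * g 0
  ⊛-tailʳ f g zero    = solve 4 (λ f₀ f₁ g₀ g₁ → f₀ :* g₁ :+ (f₁ :* g₀ :+ con 0ℚ)
    := (f₀ :* g₁ :+ con 0ℚ) :+ f₁ :* g₀) refl (f 0) (f 1) (g 0) (g 1)
  ⊛-tailʳ f g (suc k) = trans (+-congˡ (⊛-tailʳ (tail f) g k)) (sym (+-assoc _ _ _))

  ⊛-comm : ∀ f g → f ⊛ g ≋ g ⊛ f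
  ⊛-comm f g zero    = +-congʳ (*-comm (f 0) (g 0))
  ⊛-comm f g (suc k) = begin
    f 0 * g (suc k) + (tail f ⊛ g) k  ≈⟨ +-cong (*-comm _ _) (⊛-comm (tail f) g k) ⟩
    g (suc k) * f 0 + (g ⊛ tail f) k  ≈⟨ +-comm _ _ ⟩
    (g ⊛ tail f) k + g (suc k) * f 0  ≈⟨ ⊛-tailʳ g f k ⟨
    (g ⊛ f) (suc k)                   ∎

  ⊛-assoc : ∀ f g h → (f ⊛ g) ⊛ h ≋ f ⊛ (g ⊛ h)
  ⊛-assoc f g h zero = solve 3 (λ f g h → (f :* g :+ con 0ℚ) :* h :+ con 0ℚ
    := f :* (g :* h :+ con 0ℚ) :+ con 0ℚ) refl (f 0) (g 0) (h 0)
  ⊛-assoc f g h (suc k) = begin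
    (f 0 * g 0 + 0#) * h (suc k) + (((f 0 · tail g) ⊕ (tail f ⊛ g)) ⊛ h) k
      ≈⟨ +-congˡ (⊛-distribʳ h (f 0 · tail g) (tail f ⊛ g) k) ⟩
    (f 0 * g 0 + 0#) * h (suc k) + (((f 0 · tail g) ⊛ h) k + ((tail f ⊛ g) ⊛ h) k)
      ≈⟨ +-congˡ (+-cong (·-⊛-assoc (f 0) (tail g) h k) (⊛-assoc (tail f) g h k)) ⟩
    (f 0 * g 0 + 0#) * h (suc k) + (f 0 * (tail g ⊛ h) k + (tail f ⊛ (g ⊛ h)) k)
      ≈⟨ solve 5 (λ f g h a b → (f :* g :+ con 0ℚ) :* h :+ (f :* a :+ b)
           := f :* (g :* h :+ a) :+ b) refl (f 0) (g 0) (h (suc k)) _ _ ⟩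
    f 0 * (g 0 * h (suc k) + (tail g ⊛ h) k) + (tail f ⊛ (g ⊛ h)) k  ∎

  const-⊛ : ∀ a f → const a ⊛ f ≋ a · f
  const-⊛ a f zero    = +-identityʳ _
  const-⊛ a f (suc k) = trans
    (+-congˡ (trans (⊛-comm (λ _ → 0#) f k) (⊛-vanish f (λ _ → 0#) k (λ _ _ → refl))))
    (+-identityʳ _)

  one≋const : one ≋ const 1#
  one≋const zero    = refl
  one≋const (suc _) = refl

  ⊛-identityˡ : ∀ f → one ⊛ f ≋ f
  ⊛-identityˡ f k = trans (⊛-cong {g = f} one≋const (λ _ → refl) k)
    (trans (const-⊛ 1# f k) (*-identityˡ (f k)))

  seriesRing : CommutativeRing c ℓ
  seriesRing = record
    { Carrier = Series
    ; _≈_     = _≋_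
    ; _+_     = _⊕_
    ; _*_     = _⊛_
    ; -_      = λ f k → - f k
    ; 0#      = λ _ → 0#
    ; 1#      = one
    ; isCommutativeRing = record
      { isRing = record
        { +-isAbelianGroup = record
          { isGroup = record
            { isMonoid = record
              { isSemigroup = record
                { isMagma = record
                  { isEquivalence = record
                    { refl  = λ _ → refl
                    ; sym   = λ p k → sym (p k)
                    ; trans = λ p q k → trans (p k) (q k)
                    }
                  ; ∙-cong = λ p q k → +-cong (p k) (q k)
                  }
                ; assoc = λ f g h k → +-assoc (f k) (g k) (h k)
                }
              ; identity = (λ f k → +-identityˡ (f k)) , (λ f k → +-identityʳ (f k))
              }
            ; inverse = (λ f k → -‿inverseˡ (f k)) , (λ f k → -‿inverseʳ (f k))
            ; ⁻¹-cong = λ p k → -‿cong (p k)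
            }
          ; comm = λ f g k → +-comm (f k) (g k)
          }
        ; *-cong     = ⊛-cong
        ; *-assoc    = ⊛-assoc
        ; *-identity = ⊛-identityˡ ,
            (λ f k → trans (⊛-comm f one k) (⊛-identityˡ f k))
        ; distrib    = (λ h f g k → trans (⊛-comm h (f ⊕ g) k)
            (trans (⊛-distribʳ h f g k) (+-cong (⊛-comm f h k) (⊛-comm g h k))))
            , ⊛-distribʳ
        }
      ; *-comm = ⊛-comm
      }
    }

  const-isRingHomomorphism :
    IsRingHomomorphism rawRing (CommutativeRing.rawRing seriesRing) const
  const-isRingHomomorphism = record
    { isSemiringHomomorphism = record
      { isNearSemiringHomomorphism = record
        { +-isMonoidHomomorphism = record
          { isMagmaHomomorphism = record
            { isRelHomomorphism = record
              { cong = λ { p zero → p ; p (suc _) → refl } }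
            ; homo = λ { a b zero → refl ; a b (suc _) → sym (+-identityˡ 0#) }
            }
          ; ε-homo = λ { zero → refl ; (suc _) → refl }
          }
        ; *-homo = λ { a b zero → sym (const-⊛ a (const b) zero)
                     ; a b (suc k) → sym (trans (const-⊛ a (const b) (suc k)) (zeroʳ a)) }
        }
      ; 1#-homo = λ k → sym (one≋const k)
      }
    ; -‿homo = λ { a zero → refl ; a (suc _) → sym -0#≈0# }
    }

  module const = IsRingHomomorphism const-isRingHomomorphism

  const∘ι-isRingHomomorphism :
    IsRingHomomorphism ℚ.+-*-rawRing (CommutativeRing.rawRing seriesRing) (const ∘ ι)
  const∘ι-isRingHomomorphism = Composition.isRingHomomorphism (CommutativeRing.trans seriesRing)
    ι-isRingHomomorphism const-isRingHomomorphism

  module S where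
    open CommutativeRing seriesRing public hiding (zero)
    open RawSemiringDefs (Semiring.rawSemiring (CommutativeRing.semiring seriesRing)) public
      using (_×_; _^_)
    open RationalAlgebraSolver seriesRing (const ∘ ι) const∘ι-isRingHomomorphism public
    open SetoidReasoning (CommutativeRing.setoid seriesRing) public

  private
    -- The operator `x d/dx`. It preserves degrees, so its product rule passes through the recursion
    -- on `tail`; `D` is its shift by one.
    euler : Series → Series
    euler f k = k × f k

    euler-⊛ : ∀ f g → euler (f ⊛ g) ≋ (euler f ⊛ g) ⊕ (f ⊛ euler g)
    euler-⊛ f g zero = solve 2 (λ f g → con 0ℚ := (con 0ℚ :* g :+ con 0ℚ) :+ (f :* con 0ℚ :+ con 0ℚ))
      refl (f 0) (g 0)
    euler-⊛ f g (suc k) = begin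
      suc k × (f 0 * g (suc k) + (tail f ⊛ g) k)
        ≈⟨ ×-distrib-+ _ _ (suc k) ⟩
      suc k × (f 0 * g (suc k)) + ((tail f ⊛ g) k + euler (tail f ⊛ g) k)
        ≈⟨ +-cong (sym (×-comm-* (suc k) (f 0) (g (suc k)))) (+-congˡ (euler-⊛ (tail f) g k)) ⟩
      f 0 * (suc k × g (suc k)) +
        ((tail f ⊛ g) k + ((euler (tail f) ⊛ g) k + (tail f ⊛ euler g) k))
        ≈⟨ solve 5 (λ x y a b c → x :+ (a :+ (b :+ c)) := (con 0ℚ :* y :+ (a :+ b)) :+ (x :+ c))
             refl _ (g (suc k)) _ _ _ ⟩
      (0# * g (suc k) + ((tail f ⊛ g) k + (euler (tail f) ⊛ g) k)) +
        (f 0 * (suc k × g (suc k)) + (tail f ⊛ euler g) k)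
        ≈⟨ +-congʳ (+-congˡ (⊛-distribʳ g (tail f) (euler (tail f)) k)) ⟨
      (euler f ⊛ g) (suc k) + (f ⊛ euler g) (suc k)  ∎

  D : Series → Series
  D f k = suc k × f (suc k)

  D-cong : ∀ {f g} → f ≋ g → D f ≋ D g
  D-cong p k = ×-congʳ (suc k) (p (suc k))

  D-⊕ : ∀ f g → D (f ⊕ g) ≋ D f ⊕ D g
  D-⊕ f g k = ×-distrib-+ (f (suc k)) (g (suc k)) (suc k)

  D-· : ∀ a f → D (a · f) ≋ a · D f
  D-· a f k = sym (×-comm-* (suc k) a (f (suc k)))

  D-⊛ : ∀ f g → D (f ⊛ g) ≋ (D f ⊛ g) ⊕ (f ⊛ D g)
  D-⊛ f g k = begin
    euler (f ⊛ g) (suc k)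
      ≈⟨ euler-⊛ f g (suc k) ⟩
    (0# * g (suc k) + (D f ⊛ g) k) + (f ⊛ euler g) (suc k)
      ≈⟨ +-congˡ (⊛-tailʳ f (euler g) k) ⟩
    (0# * g (suc k) + (D f ⊛ g) k) + ((f ⊛ D g) k + f (suc k) * 0#)
      ≈⟨ solve 4 (λ x y a b → (con 0ℚ :* x :+ a) :+ (b :+ y :* con 0ℚ) := a :+ b) refl _ _ _ _ ⟩
    (D f ⊛ g) k + (f ⊛ D g) k  ∎

-- Unnormalised fractions allow comparison by cross multiplication, free of greatest common
-- divisors.
1/n+m/n : ∀ m n → .{{_ : ℕ.NonZero n}} → (+ 1 ℚ./ n) ℚ.+ (+ m ℚ./ n) ≡ + suc m ℚ./ n
1/n+m/n m n@(suc d) = ℚ.toℚᵘ-injective (begin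
  ℚ.toℚᵘ ((+ 1 ℚ./ n) ℚ.+ (+ m ℚ./ n))
    ≈⟨ ℚ.toℚᵘ-homo-+ (+ 1 ℚ./ n) (+ m ℚ./ n) ⟩
  ℚ.toℚᵘ (+ 1 ℚ./ n) ℚᵘ.+ ℚ.toℚᵘ (+ m ℚ./ n)
    ≈⟨ ℚᵘ.+-cong (ℚ.toℚᵘ-fromℚᵘ (mkℚᵘ (+ 1) d)) (ℚ.toℚᵘ-fromℚᵘ (mkℚᵘ (+ m) d)) ⟩
  mkℚᵘ (+ 1) d ℚᵘ.+ mkℚᵘ (+ m) d
    ≈⟨ *≡* (≡.trans (≡.cong (ℤ._* + n) (≡.sym (ℤ.*-distribʳ-+ (+ n) (+ 1) (+ m))))
                    (ℤ.*-assoc (+ suc m) (+ n) (+ n))) ⟩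
  mkℚᵘ (+ suc m) d
    ≈⟨ ℚ.toℚᵘ-fromℚᵘ (mkℚᵘ (+ suc m) d) ⟨
  ℚ.toℚᵘ (+ suc m ℚ./ n)  ∎)
  where
  open SetoidReasoning ℚᵘ.≃-setoid

n/n≡1 : ∀ n → .{{_ : ℕ.NonZero n}} → + n ℚ./ n ≡ 1ℚ
n/n≡1 n@(suc d) = ℚ.fromℚᵘ-cong {mkℚᵘ (+ n) d} {mkℚᵘ (+ 1) 0} (*≡* (ℤ.*-comm (+ n) (+ 1)))

-- Derivatives of sine and cosine, and the Pythagorean identity.

module SineCosine {c ℓ} (K : CommutativeRing c ℓ)
  (ι : ℚ → CommutativeRing.Carrier K)
  (ι-isRingHomomorphism :
    IsRingHomomorphism ℚ.+-*-rawRing (CommutativeRing.rawRing K) ι)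
  where

  open CommutativeRing K hiding (zero)
  open PowerSeries K ι ι-isRingHomomorphism
  open SeriesRing K ι ι-isRingHomomorphism
  open RingProperties ring using (-0#≈0#; -‿distribˡ-*)
  open RawSemiringDefs (Semiring.rawSemiring semiring) using (_×_)
  open SemiringMult semiring using (×-comm-*; ×-assoc-*; ×-assocˡ)
  open SetoidReasoning setoid
  private
    module ι = IsRingHomomorphism ι-isRingHomomorphism

  m×ι1/n : ∀ m n → .{{_ : ℕ.NonZero n}} → m × ι (+ 1 ℚ./ n) ≈ ι (+ m ℚ./ n)
  m×ι1/n zero    n@(suc d) = trans (sym ι.0#-homo) (reflexive (≡.cong ι
    (ℚ.fromℚᵘ-cong {mkℚᵘ (+ 0) 0} {mkℚᵘ (+ 0) d} (*≡* ≡.refl))))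
  m×ι1/n (suc m) n = begin
    ι (+ 1 ℚ./ n) + m × ι (+ 1 ℚ./ n)    ≈⟨ +-congˡ (m×ι1/n m n) ⟩
    ι (+ 1 ℚ./ n) + ι (+ m ℚ./ n)        ≈⟨ ι.+-homo _ _ ⟨
    ι ((+ 1 ℚ./ n) ℚ.+ (+ m ℚ./ n))      ≈⟨ reflexive (≡.cong ι (1/n+m/n m n)) ⟩
    ι (+ suc m ℚ./ n)                    ∎

  n×ι1/n≈1 : ∀ n → .{{_ : ℕ.NonZero n}} → n × ι (+ 1 ℚ./ n) ≈ 1#
  n×ι1/n≈1 n = trans (m×ι1/n n n) (trans (reflexive (≡.cong ι (n/n≡1 n))) ι.1#-homo)

  -- Multiplication by `ι (1/n)` undoes that by `n`. This makes a series with zero derivative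
  -- constant.
  n×a≈0⇒a≈0 : ∀ n → .{{_ : ℕ.NonZero n}} → ∀ a → n × a ≈ 0# → a ≈ 0#
  n×a≈0⇒a≈0 n a na≈0 = begin
    a                        ≈⟨ *-identityˡ a ⟨
    1# * a                   ≈⟨ *-congʳ (n×ι1/n≈1 n) ⟨
    n × ι (+ 1 ℚ./ n) * a    ≈⟨ ×-assoc-* n _ a ⟩
    n × (ι (+ 1 ℚ./ n) * a)  ≈⟨ ×-comm-* n _ a ⟨
    ι (+ 1 ℚ./ n) * n × a    ≈⟨ trans (*-congˡ na≈0) (zeroʳ _) ⟩
    0#                       ∎

  [1+k]×1/[1+k]! : ∀ k → suc k × 1/ suc k ! ≈ 1/ k !
  [1+k]×1/[1+k]! k = begin
    suc k × a                  ≈⟨ trans (*-congʳ k!b≈1) (*-identityˡ _) ⟨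
    (k !) × b * suc k × a      ≈⟨ ×-assoc-* (k !) b _ ⟩
    (k !) × (b * suc k × a)    ≈⟨ ×-comm-* (k !) b _ ⟨
    b * (k !) × (suc k × a)    ≈⟨ *-congˡ (×-assocˡ a (k !) (suc k)) ⟩
    b * ((k !) ℕ.* suc k) × a  ≈⟨ *-congˡ (reflexive (≡.cong (_× a) (ℕ.*-comm (k !) (suc k)))) ⟩
    b * (suc k !) × a          ≈⟨ trans (*-congˡ [1+k]!a≈1) (*-identityʳ b) ⟩
    b                          ∎
    where
    a = 1/ suc k !
    b = 1/ k !
    k!b≈1 : (k !) × b ≈ 1#
    k!b≈1 = n×ι1/n≈1 (k !) {{k ℕ.!≢0}}
    [1+k]!a≈1 : (suc k !) × a ≈ 1#
    [1+k]!a≈1 = n×ι1/n≈1 (suc k !) {{suc k ℕ.!≢0}}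

  sin⁽1+k⁾ : ∀ k → sin⁽ suc k ⁾ ≈ cos⁽ k ⁾
  sin⁽1+k⁾ 0             = refl
  sin⁽1+k⁾ 1             = -0#≈0#
  sin⁽1+k⁾ (suc (suc k)) = -‿cong (sin⁽1+k⁾ k)

  cos⁽1+k⁾ : ∀ k → cos⁽ suc k ⁾ ≈ - sin⁽ k ⁾
  cos⁽1+k⁾ 0             = sym -0#≈0#
  cos⁽1+k⁾ 1             = refl
  cos⁽1+k⁾ (suc (suc k)) = -‿cong (cos⁽1+k⁾ k)

  D-sin : D sin ≋ cos
  D-sin k = trans (sym (×-comm-* (suc k) _ _)) (*-cong (sin⁽1+k⁾ k) ([1+k]×1/[1+k]! k))

  D-cos : D cos ≋ S.- sin
  D-cos k = trans (sym (×-comm-* (suc k) _ _)) (trans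
    (*-cong (cos⁽1+k⁾ k) ([1+k]×1/[1+k]! k)) (sym (-‿distribˡ-* _ _)))

  D≋0⇒const : ∀ f → D f ≋ S.0# → f ≋ const (f 0)
  D≋0⇒const f Df≋0 zero    = refl
  D≋0⇒const f Df≋0 (suc k) = n×a≈0⇒a≈0 (suc k) (f (suc k)) (Df≋0 k)

  sin₀≈0 : sin 0 ≈ 0#
  sin₀≈0 = zeroˡ _

  sin₁≈1 : sin 1 ≈ 1#
  sin₁≈1 = trans (*-identityˡ _) ι.1#-homo

  -- The left side has derivative zero and constant term 1.
  sin²+cos²≋1 : sin ⊛ sin ⊕ cos ⊛ cos ≋ one
  sin²+cos²≋1 = S.begin
    h              S.≈⟨ D≋0⇒const h Dh≋0 ⟩
    const (h 0)    S.≈⟨ const.⟦⟧-cong h₀≈1 ⟩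
    const 1#       S.≈⟨ one≋const ⟨
    one            S.∎
    where
    h = sin ⊛ sin ⊕ cos ⊛ cos
    h₀≈1 : h 0 ≈ 1#
    h₀≈1 = trans (+-cong (trans (+-identityʳ _) (trans (*-congʳ sin₀≈0) (zeroˡ _))) cos²₀≈1)
                 (+-identityˡ 1#)
    Dh≋0 : D h ≋ S.0#
    Dh≋0 = S.begin
      D h
        S.≈⟨ S.trans (D-⊕ (sin ⊛ sin) (cos ⊛ cos)) (S.+-cong (D-⊛ sin sin) (D-⊛ cos cos)) ⟩
      (D sin ⊛ sin ⊕ sin ⊛ D sin) ⊕ (D cos ⊛ cos ⊕ cos ⊛ D cos)
        S.≈⟨ S.+-cong (S.+-cong (S.*-congʳ D-sin) (S.*-congˡ {sin} D-sin))
                      (S.+-cong (S.*-congʳ D-cos) (S.*-congˡ {cos} D-cos)) ⟩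
      (cos ⊛ sin ⊕ sin ⊛ cos) ⊕ ((S.- sin) ⊛ cos ⊕ cos ⊛ (S.- sin))
        S.≈⟨ S.solve 2 (λ s c → (c S.:* s S.:+ s S.:* c) S.:+ ((S.:- s) S.:* c S.:+ c S.:* (S.:- s))
               S.:= S.con 0ℚ) S.refl sin cos ⟩
      S.0#  S.∎

-- Identities for `y` from the ring laws, a derivation and the relations between sine, cosine and
-- `y`.

module DifferentialAlgebra {c ℓ} (R : CommutativeRing c ℓ)
  (ι : ℚ → CommutativeRing.Carrier R)
  (ι-isRingHomomorphism :
    IsRingHomomorphism ℚ.+-*-rawRing (CommutativeRing.rawRing R) ι)
  where

  open CommutativeRing R hiding (zero)
  open RawSemiringDefs (Semiring.rawSemiring semiring) using (_×_; _^_)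
  open SemiringMult semiring using (×-congʳ; ×-comm-*; ×-assoc-*)
  open RationalAlgebraSolver R ι ι-isRingHomomorphism
  open SetoidReasoning setoid

  module _ (∂ : Carrier → Carrier)
    (∂-cong : ∀ {a b} → a ≈ b → ∂ a ≈ ∂ b)
    (∂-+ : ∀ a b → ∂ (a + b) ≈ ∂ a + ∂ b)
    (∂-* : ∀ a b → ∂ (a * b) ≈ ∂ a * b + a * ∂ b)
    where

    ∂-0 : ∂ 0# ≈ 0#
    ∂-0 = begin
      ∂ 0#                     ≈⟨ solve 1 (λ a → a := a :+ a :- a) refl (∂ 0#) ⟩
      ∂ 0# + ∂ 0# - ∂ 0#       ≈⟨ +-congʳ (∂-+ 0# 0#) ⟨
      ∂ (0# + 0#) - ∂ 0#       ≈⟨ +-congʳ (∂-cong (+-identityˡ 0#)) ⟩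
      ∂ 0# - ∂ 0#              ≈⟨ -‿inverseʳ (∂ 0#) ⟩
      0#                       ∎

    ∂-1 : ∂ 1# ≈ 0#
    ∂-1 = begin
      ∂ 1#
        ≈⟨ solve 1 (λ a → a := (a :* con 1ℚ :+ con 1ℚ :* a) :- a) refl (∂ 1#) ⟩
      (∂ 1# * 1# + 1# * ∂ 1#) - ∂ 1#
        ≈⟨ +-congʳ (∂-* 1# 1#) ⟨
      ∂ (1# * 1#) - ∂ 1#
        ≈⟨ +-congʳ (∂-cong (*-identityˡ 1#)) ⟩
      ∂ 1# - ∂ 1#
        ≈⟨ -‿inverseʳ (∂ 1#) ⟩
      0#  ∎

    ∂-× : ∀ m a → ∂ (m × a) ≈ m × ∂ a
    ∂-× zero    a = ∂-0
    ∂-× (suc m) a = trans (∂-+ a (m × a)) (+-congˡ (∂-× m a))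

    module _ {sin cos y : Carrier} (∂-sin : ∂ sin ≈ cos) (∂-cos : ∂ cos ≈ - sin)
      (y*cos² : y * (cos * cos) ≈ sin + 1#) (y≈1+sin*y : y ≈ 1# + sin * y)
      where

      -- Multiplication by `y` serves as division by `1 - sin`, because `1 = y - sin * y`.
      -- Differentiating this relation gives `∂ y - sin * ∂ y = cos * y`.
      ∂-y : ∂ y ≈ y * y * cos
      ∂-y = begin
        ∂ y
          ≈⟨ solve 3 (λ y y′ s → y′ := ((con 1ℚ :+ s :* y) :- s :* y) :* y′) refl y (∂ y) sin ⟩
        (1# + sin * y - sin * y) * ∂ y
          ≈⟨ *-congʳ (+-congʳ y≈1+sin*y) ⟨
        (y - sin * y) * ∂ y
          ≈⟨ solve 3 (λ y y′ s → (y :- s :* y) :* y′ := y :* (y′ :- s :* y′)) refl y (∂ y) sin ⟩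
        y * (∂ y - sin * ∂ y)
          ≈⟨ *-congˡ (+-congʳ (begin
               ∂ y                           ≈⟨ ∂-cong y≈1+sin*y ⟩
               ∂ (1# + sin * y)              ≈⟨ ∂-+ 1# (sin * y) ⟩
               ∂ 1# + ∂ (sin * y)            ≈⟨ +-cong ∂-1 (∂-* sin y) ⟩
               0# + (∂ sin * y + sin * ∂ y)  ≈⟨ +-identityˡ _ ⟩
               ∂ sin * y + sin * ∂ y         ≈⟨ +-congʳ (*-congʳ ∂-sin) ⟩
               cos * y + sin * ∂ y           ∎)) ⟩
        y * (cos * y + sin * ∂ y - sin * ∂ y)
          ≈⟨ solve 3 (λ y c a → y :* (c :* y :+ a :- a) := y :* y :* c) refl y cos (sin * ∂ y) ⟩
        y * y * cos  ∎

      -- The factor `y * y` in `∂ y` makes the exponent rise rather than fall, so that no exponent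
      -- `m - 1` occurs.
      ∂-y^ : ∀ m → ∂ (y ^ m) ≈ m × (y * (y ^ m) * cos)
      ∂-y^ zero    = ∂-1
      ∂-y^ (suc m) = begin
        ∂ (y * Y)
          ≈⟨ ∂-* y Y ⟩
        ∂ y * Y + y * ∂ Y
          ≈⟨ +-cong (*-congʳ ∂-y) (*-congˡ (∂-y^ m)) ⟩
        y * y * cos * Y + y * m × (y * Y * cos)
          ≈⟨ +-cong (solve 3 (λ y Y c → y :* y :* c :* Y := y :* (y :* Y) :* c) refl y Y cos)
                    (×-comm-* m y _) ⟩
        y * (y * Y) * cos + m × (y * (y * Y * cos))
          ≈⟨ +-congˡ (×-congʳ m (sym (*-assoc y (y * Y) cos))) ⟩
        suc m × (y * (y * Y) * cos)  ∎
        where Y = y ^ m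

      -- Once `y * cos²` has become `sin + 1`, the added square `n * n` completes `n * (sin * y)` to
      -- `n * (1 + sin * y) = n * y`. Together with `(1 + n) * y` this makes `(2 n + 1) * y`.
      ∂²-y^ : ∀ m → let n = m × 1# in
        ∂ (∂ (y ^ m)) + n * n * (y ^ m) ≈ n * (n + n + 1#) * (y ^ suc m)
      ∂²-y^ m = begin
        ∂ (∂ Y) + n * n * Y
          ≈⟨ +-congʳ (trans (∂-cong (∂-y^ m)) (∂-× m (y * Y * cos))) ⟩
        m × ∂ (y * Y * cos) + n * n * Y
          ≈⟨ +-congʳ (trans (m×≈n* _) (*-congˡ (trans (∂-* (y * Y) cos)
               (+-cong (*-congʳ (trans (∂-* y Y)
                 (+-cong (*-congʳ ∂-y) (*-congˡ (trans (∂-y^ m) (m×≈n* _))))))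
                 (*-congˡ ∂-cos))))) ⟩
        n * ((y * y * cos * Y + y * (n * (y * Y * cos))) * cos + y * Y * - sin) + n * n * Y
          ≈⟨ solve 5 (λ y Y s c n →
               n :* ((y :* y :* c :* Y :+ y :* (n :* (y :* Y :* c))) :* c
                 :+ y :* Y :* (:- s)) :+ n :* n :* Y
               := n :* Y :* ((con 1ℚ :+ n) :* y :* (y :* (c :* c)) :- s :* y :+ n))
               refl y Y sin cos n ⟩
        n * Y * ((1# + n) * y * (y * (cos * cos)) - sin * y + n)
          ≈⟨ *-congˡ (+-congʳ (+-congʳ (*-congˡ y*cos²))) ⟩
        n * Y * ((1# + n) * y * (sin + 1#) - sin * y + n)
          ≈⟨ solve 4 (λ y Y s n →
               n :* Y :* ((con 1ℚ :+ n) :* y :* (s :+ con 1ℚ) :- s :* y :+ n)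
               := n :* Y :* (n :* (con 1ℚ :+ s :* y) :+ (con 1ℚ :+ n) :* y))
               refl y Y sin n ⟩
        n * Y * (n * (1# + sin * y) + (1# + n) * y)
          ≈⟨ *-congˡ (+-congʳ (*-congˡ y≈1+sin*y)) ⟨
        n * Y * (n * y + (1# + n) * y)
          ≈⟨ solve 3 (λ y Y n → n :* Y :* (n :* y :+ (con 1ℚ :+ n) :* y)
               := n :* (n :+ n :+ con 1ℚ) :* (y :* Y)) refl y Y n ⟩
        n * (n + n + 1#) * (y * Y)  ∎
        where
        Y = y ^ m
        n = m × 1#
        m×≈n* : ∀ a → m × a ≈ n * a
        m×≈n* a = sym (trans (×-assoc-* m 1# a) (×-congʳ m (*-identityˡ a)))

  module _ {sin y : Carrier} (y≈1+sin*y : y ≈ 1# + sin * y) where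

    -- As `sin * y = y - 1`, multiplication by it is `T - 1` for `T` multiplication by `y`, in the
    -- form that `det-newton` asks for.
    w*-step : ∀ W Y → sin * y * W * Y ≈ - 1# * (W * Y) + W * (y * Y)
    w*-step W Y = begin
      sin * y * W * Y
        ≈⟨ solve 4 (λ s y W Y → s :* y :* W :* Y
             := :- con 1ℚ :* (W :* Y) :+ W :* ((con 1ℚ :+ s :* y) :* Y)) refl sin y W Y ⟩
      - 1# * (W * Y) + W * ((1# + sin * y) * Y)
        ≈⟨ +-congˡ (*-congˡ (*-congʳ y≈1+sin*y)) ⟨
      - 1# * (W * Y) + W * (y * Y)  ∎

    -- One step of the expansion in powers of `w = sin * y = y - 1`. Here `t` and `n` play the parts
    -- of `k choose 2` and `k`, and Pascal's rule yields their successors `n + t` and `1 + n`. The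
    -- terms free of `σ` combine by `y + w * y = y²`, those with `σ` to `(t + n) * y²`.
    G-step : ∀ W σ t n →
      W * (y - σ * (t * y + n - sin))
        ≈ (1# - σ * (t + n)) * (W * (y * (y * 1#)))
          - sin * y * W * (y - σ * ((n + t) * y + (1# + n) - sin))
    G-step W σ t n = begin
      W * (y - σ * (t * y + n - sin))
        -- As polynomials the two sides differ by a multiple of `1 + sin * y - y`; the last summand
        -- is this multiple, and the relation for `y` then removes it.
        ≈⟨ solve 6 (λ W σ t n y s →
             W :* (y :- σ :* (t :* y :+ n :- s))
             := (con 1ℚ :- σ :* (t :+ n)) :* (W :* (y :* (y :* con 1ℚ)))
                :- s :* y :* W :* (y :- σ :* ((n :+ t) :* y :+ (con 1ℚ :+ n) :- s))
                :+ W :* (y :+ σ :* (s :- n :- (t :+ n) :* y)) :* ((con 1ℚ :+ s :* y) :- y))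
             refl W σ t n y sin ⟩
      rhs + W * (y + σ * (sin - n - (t + n) * y)) * (1# + sin * y - y)
        ≈⟨ +-congˡ (*-congˡ (+-congʳ y≈1+sin*y)) ⟨
      rhs + W * (y + σ * (sin - n - (t + n) * y)) * (y - y)
        ≈⟨ +-congˡ (trans (*-congˡ (-‿inverseʳ y)) (zeroʳ _)) ⟩
      rhs + 0#
        ≈⟨ +-identityʳ rhs ⟩
      rhs  ∎
      where
      rhs = (1# - σ * (t + n)) * (W * (y * (y * 1#)))
            - sin * y * W * (y - σ * ((n + t) * y + (1# + n) - sin))

  -- Here r and r′ stand for the reciprocals of cos² and 1 + sin.
  y≈1+sin*y : ∀ {sin cos r r′ : Carrier} → sin * sin + cos * cos ≈ 1# →
    cos * cos * r ≈ 1# → (sin + 1#) * r′ ≈ 1# →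
    (sin + 1#) * r ≈ 1# + sin * ((sin + 1#) * r)
  y≈1+sin*y {sin} {cos} {r} {r′} pyth cos²r pr′ = begin
    p * r
      ≈⟨ solve 2 (λ y s → y := y :* (con 1ℚ :- s) :* con 1ℚ :+ s :* y) refl (p * r) sin ⟩
    p * r * (1# - sin) * 1# + sin * (p * r)
      ≈⟨ +-congʳ (*-congˡ pr′) ⟨
    p * r * (1# - sin) * (p * r′) + sin * (p * r)
      ≈⟨ +-congʳ (solve 3 (λ s r r′ → let p = s :+ con 1ℚ in
           p :* r :* (con 1ℚ :- s) :* (p :* r′)
           := (con 1ℚ :- s :* s) :* r :* (p :* r′)) refl sin r r′) ⟩
    (1# - sin * sin) * r * (p * r′) + sin * (p * r)
      ≈⟨ +-congʳ (*-cong (*-congʳ (+-congʳ (sym pyth))) pr′) ⟩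
    (sin * sin + cos * cos - sin * sin) * r * 1# + sin * (p * r)
      ≈⟨ +-congʳ (solve 3 (λ a b r → (a :+ b :- a) :* r :* con 1ℚ := b :* r) refl
           (sin * sin) (cos * cos) r) ⟩
    cos * cos * r + sin * (p * r)
      ≈⟨ +-congʳ cos²r ⟩
    1# + sin * (p * r)  ∎
    where p = sin + 1#

  sin³+1/cos² : ∀ {sin cos r : Carrier} → sin * sin + cos * cos ≈ 1# → cos * cos * r ≈ 1# →
    (sin + 1#) * r - sin ≈ (sin * sin * sin + 1#) * r
  sin³+1/cos² {sin} {cos} {r} pyth cos²r = begin
    (sin + 1#) * r - sin
      ≈⟨ +-congˡ (-‿cong (trans (*-congˡ cos²r) (*-identityʳ sin))) ⟨
    (sin + 1#) * r - sin * (cos * cos * r)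
      ≈⟨ solve 3 (λ s c r → (s :+ con 1ℚ) :* r :- s :* (c :* c :* r)
           := (s :* (con 1ℚ :- c :* c) :+ con 1ℚ) :* r) refl sin cos r ⟩
    (sin * (1# - cos * cos) + 1#) * r
      ≈⟨ *-congʳ (+-congʳ (*-congˡ (+-congʳ pyth))) ⟨
    (sin * (sin * sin + cos * cos - cos * cos) + 1#) * r
      ≈⟨ solve 3 (λ s c r → (s :* (s :* s :+ c :* c :- c :* c) :+ con 1ℚ) :* r
           := (s :* s :* s :+ con 1ℚ) :* r) refl sin cos r ⟩
    (sin * sin * sin + 1#) * r  ∎

-- Factorisation of the product of factorials and double factorials.

product-applyUpTo-snoc : ∀ f n → product (applyUpTo f (suc n)) ≡ product (applyUpTo f n) ℕ.* f n
product-applyUpTo-snoc f n = begin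
  product (applyUpTo f (suc n))          ≡⟨ ≡.cong product (applyUpTo-∷ʳ f n) ⟨
  product (applyUpTo f n ∷ʳ f n)         ≡⟨ product-++ (applyUpTo f n) _ ⟩
  product (applyUpTo f n) ℕ.* (f n ℕ.* 1)  ≡⟨ ≡.cong (product (applyUpTo f n) ℕ.*_) (ℕ.*-identityʳ (f n)) ⟩
  product (applyUpTo f n) ℕ.* f n          ∎
  where open ≡.≡-Reasoning

product-applyUpTo-* : ∀ {f g h : ℕ → ℕ} → (∀ k → f k ℕ.* g k ≡ h k) → ∀ n →
  product (applyUpTo f n) ℕ.* product (applyUpTo g n) ≡ product (applyUpTo h n)
product-applyUpTo-* fg≡h zero = ≡.refl
product-applyUpTo-* {f} {g} fg≡h (suc n) = ≡.trans
  (ℕ.[m*n]*[o*p]≡[m*o]*[n*p] (f 0) _ (g 0) _)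
  (≡.cong₂ ℕ._*_ (fg≡h 0) (product-applyUpTo-* (λ k → fg≡h (suc k)) n))

-- The product of the constants `m (2m + 1)` for `m = 1, …, k`, which the operators `D² + m²` leave
-- in front of `y ^ (k + 1)`.
rowFactor : ℕ → ℕ
rowFactor k = k ! ℕ.* oddDoubleFactorial k

rowFactor-suc : ∀ k → rowFactor (suc k) ≡ rowFactor k ℕ.* (suc k ℕ.* (suc k ℕ.+ suc k ℕ.+ 1))
rowFactor-suc k = begin
  suc k ℕ.* k ! ℕ.* oddDoubleFactorial (suc k)
    ≡⟨ ≡.cong (suc k ℕ.* k ! ℕ.*_) (product-applyUpTo-snoc (λ i → 2 ℕ.* i ℕ.+ 1) (suc k)) ⟩
  suc k ℕ.* k ! ℕ.* (oddDoubleFactorial k ℕ.* (2 ℕ.* suc k ℕ.+ 1))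
    ≡⟨ rearrange (suc k) (k !) (oddDoubleFactorial k) ⟩
  k ! ℕ.* oddDoubleFactorial k ℕ.* (suc k ℕ.* (suc k ℕ.+ suc k ℕ.+ 1))  ∎
  where
  open ≡.≡-Reasoning
  rearrange : ∀ n f o →
    n ℕ.* f ℕ.* (o ℕ.* (2 ℕ.* n ℕ.+ 1)) ≡ f ℕ.* o ℕ.* (n ℕ.* (n ℕ.+ n ℕ.+ 1))
  rearrange = solve-∀

-- Of the two factors `k !`, one belongs to the row constant and the other to the diagonal entry of
-- the triangular matrix. The factors at `k = 0` are 1, which reconciles the ranges `0, …, m` and
-- `1, …, m`.
hankelProduct-factors : ∀ m →
  product (applyUpTo rowFactor (suc m)) ℕ.* product (applyUpTo _! (suc m)) ≡ hankelProduct (suc m)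
hankelProduct-factors m = ≡.trans
  (≡.cong₂ ℕ._*_ (ℕ.*-identityˡ (product (applyUpTo (rowFactor ∘ suc) m)))
                 (ℕ.*-identityˡ (product (applyUpTo (_! ∘ suc) m))))
  (product-applyUpTo-* {rowFactor ∘ suc} {_! ∘ suc}
    (λ k → rearrange (suc k !) (oddDoubleFactorial (suc k))) m)
  where
  rearrange : ∀ f o → f ℕ.* o ℕ.* f ≡ f ℕ.* (f ℕ.* 1) ℕ.* o
  rearrange = solve-∀

-- Reduction of the Hankel determinant to powers of `y`, and its evaluation.

module Hankel {c ℓ} (K : CommutativeRing c ℓ)
  (ι : ℚ → CommutativeRing.Carrier K)
  (ι-isRingHomomorphism :
    IsRingHomomorphism ℚ.+-*-rawRing (CommutativeRing.rawRing K) ι)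
  where

  open CommutativeRing K hiding (zero)
  open PowerSeries K ι ι-isRingHomomorphism
  open Determinants K ι ι-isRingHomomorphism
  open SeriesRing K ι ι-isRingHomomorphism
  open SineCosine K ι ι-isRingHomomorphism
  open RingProperties ring using (-0#≈0#; -‿involutive; -1*x≈-x)
  open RawSemiringDefs (Semiring.rawSemiring semiring) using (_×_)
  open SemiringMult semiring using (×-congʳ; ×-comm-*; ×-assoc-*; ×-homo-+; ×-assocˡ; ×1-homo-*)
  open CommutativeMonoidMult +-commutativeMonoid using (×-distrib-+)
  open SetoidReasoning setoid
  private
    module K-Solver = RationalAlgebraSolver K ι ι-isRingHomomorphism
    module DA = DifferentialAlgebra seriesRing (const ∘ ι) const∘ι-isRingHomomorphism

  r y : Series
  r = recip (cos ⊛ cos)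
  y = (sin ⊕ one) ⊛ r

  cos²⊛r≋1 : cos ⊛ cos ⊛ r ≋ one
  cos²⊛r≋1 = ⊛-recip (cos ⊛ cos) cos²₀≈1

  y≋1+sin⊛y : y ≋ one ⊕ sin ⊛ y
  y≋1+sin⊛y = DA.y≈1+sin*y {sin} {cos} {r} {recip (sin ⊕ one)} sin²+cos²≋1 cos²⊛r≋1
    (⊛-recip (sin ⊕ one) (trans (+-congʳ sin₀≈0) (+-identityˡ 1#)))

  y⊛cos²≋ : y ⊛ (cos ⊛ cos) ≋ sin ⊕ one
  y⊛cos²≋ = S.trans (S.*-assoc (sin ⊕ one) r (cos ⊛ cos)) (S.trans
    (S.*-congˡ {sin ⊕ one} (S.trans (S.*-comm r (cos ⊛ cos)) cos²⊛r≋1))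
    (S.*-identityʳ (sin ⊕ one)))

  f₋₁≋ : f[ - 1# ] ≋ ⟨sin³+1⟩/cos²
  f₋₁≋ k = trans (+-congˡ (-1*x≈-x (sin k)))
    (DA.sin³+1/cos² {sin} {cos} {r} sin²+cos²≋1 cos²⊛r≋1 k)

  ×one≋const : ∀ m → (m S.× one) ≋ const ⟦ m ⟧
  ×one≋const zero    = S.sym const.0#-homo
  ×one≋const (suc m) = S.trans (S.+-cong one≋const (×one≋const m)) (S.sym (const.+-homo 1# ⟦ m ⟧))

  D²-y^ : ∀ m i → D (D (y S.^ m)) i + ⟦ m ⟧ * ⟦ m ⟧ * (y S.^ m) i
    ≈ ⟦ m ⟧ * (⟦ m ⟧ + ⟦ m ⟧ + 1#) * (y S.^ suc m) i
  D²-y^ m i = begin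
    D (D (y S.^ m)) i + N * N * (y S.^ m) i
      ≈⟨ +-congˡ (const-⊛ (N * N) (y S.^ m) i) ⟨
    D (D (y S.^ m)) i + (const (N * N) ⊛ (y S.^ m)) i
      ≈⟨ +-congˡ (S.*-congʳ {y S.^ m} (S.trans (S.*-cong (×one≋const m) (×one≋const m))
           (S.sym (const.*-homo N N))) i) ⟨
    D (D (y S.^ m)) i + (n ⊛ n ⊛ (y S.^ m)) i
      ≈⟨ DA.∂²-y^ D D-cong D-⊕ D-⊛ {sin} {cos} {y} D-sin D-cos y⊛cos²≋ y≋1+sin⊛y m i ⟩
    (n ⊛ (n ⊕ n ⊕ one) ⊛ (y S.^ suc m)) i
      ≈⟨ S.*-congʳ {y S.^ suc m} (S.begin
           n ⊛ (n ⊕ n ⊕ one)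
             S.≈⟨ S.*-cong (×one≋const m)
                    (S.+-cong (S.+-cong (×one≋const m) (×one≋const m)) one≋const) ⟩
           const N ⊛ (const N ⊕ const N ⊕ const 1#)
             S.≈⟨ S.*-congˡ {const N} (S.+-congʳ {const 1#} (const.+-homo N N)) ⟨
           const N ⊛ (const (N + N) ⊕ const 1#)
             S.≈⟨ S.*-congˡ {const N} (const.+-homo (N + N) 1#) ⟨
           const N ⊛ const (N + N + 1#)
             S.≈⟨ const.*-homo N (N + N + 1#) ⟨
           const (N * (N + N + 1#))  S.∎) i ⟩
    (const (N * (N + N + 1#)) ⊛ (y S.^ suc m)) i
      ≈⟨ const-⊛ (N * (N + N + 1#)) (y S.^ suc m) i ⟩
    N * (N + N + 1#) * (y S.^ suc m) i  ∎
    where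
    N = ⟦ m ⟧
    n = m S.× one

  egfCoeff-cong : ∀ {f g} → f ≋ g → ∀ k → egfCoeff f k ≈ egfCoeff g k
  egfCoeff-cong f≋g k = ×-congʳ (k !) (f≋g k)

  egfCoeff-⊕ : ∀ f g k → egfCoeff (f ⊕ g) k ≈ egfCoeff f k + egfCoeff g k
  egfCoeff-⊕ f g k = ×-distrib-+ (f k) (g k) (k !)

  egfCoeff-· : ∀ a f k → egfCoeff (a · f) k ≈ a * egfCoeff f k
  egfCoeff-· a f k = sym (×-comm-* (k !) a (f k))

  -- Through this shift, row `i` of the dilated Hankel matrix lists the coefficients of `D²ⁱ f`.
  egfCoeff-D : ∀ f k → egfCoeff (D f) k ≈ egfCoeff f (suc k)
  egfCoeff-D f k = trans (×-assocˡ (f (suc k)) (k !) (suc k))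
    (reflexive (≡.cong (_× f (suc k)) (ℕ.*-comm (k !) (suc k))))

  ⟦⟧-* : ∀ m n → ⟦ m ℕ.* n ⟧ ≈ ⟦ m ⟧ * ⟦ n ⟧
  ⟦⟧-* = ×1-homo-*

  ⟦⟧-+ : ∀ m n → ⟦ m ℕ.+ n ⟧ ≈ ⟦ m ⟧ + ⟦ n ⟧
  ⟦⟧-+ = ×-homo-+ 1#

  ⟦1⟧ : ⟦ 1 ⟧ ≈ 1#
  ⟦1⟧ = +-identityʳ 1#

  -- The rows after the first reduction, without their factors `rowFactor k`. The parameter `s`
  -- survives only in row `zero`, to which no operator is applied.
  row : Carrier → ℕ → Series
  row s zero    = f[ s ]
  row s (suc k) = y S.^ suc (suc k)

  D²-row : ∀ s k i → D (D (row s k)) i + ⟦ suc k ⟧ * ⟦ suc k ⟧ * row s k i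
    ≈ ⟦ suc k ⟧ * (⟦ suc k ⟧ + ⟦ suc k ⟧ + 1#) * row s (suc k) i
  D²-row s (suc k) i = D²-y^ (suc (suc k)) i
  D²-row s zero    i = begin
    D (D (y ⊕ s · sin)) i + N * N * (y i + s * sin i)
      ≈⟨ +-congʳ (S.trans (D-cong (S.trans (D-⊕ y (s · sin)) (S.+-congˡ {D y} (D-· s sin))))
           (S.trans (D-⊕ (D y) (s · D sin)) (S.+-congˡ {D (D y)} (D-· s (D sin)))) i) ⟩
    D (D y) i + s * D (D sin) i + N * N * (y i + s * sin i)
      ≈⟨ +-congʳ (+-congˡ (*-congˡ (S.trans (D-cong D-sin) D-cos i))) ⟩
    D (D y) i + s * - sin i + N * N * (y i + s * sin i)
      ≈⟨ K-Solver.solve 5 (λ d s σ N y → d :+ s :* (:- σ) :+ N :* N :* (y :+ s :* σ)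
           := d :+ N :* N :* y :+ (N :* N :- con 1ℚ) :* (s :* σ)) refl (D (D y) i) s (sin i) N (y i) ⟩
    D (D y) i + N * N * y i + (N * N - 1#) * (s * sin i)
      -- Here `D² + 1` annihilates the sine: what remains of it has coefficient `1² - 1`.
      ≈⟨ +-congˡ (trans (*-congʳ (trans (+-congʳ (trans (*-cong ⟦1⟧ ⟦1⟧) (*-identityˡ 1#)))
           (-‿inverseʳ 1#))) (zeroˡ _)) ⟩
    D (D y) i + N * N * y i + 0#
      ≈⟨ +-identityʳ _ ⟩
    D (D y) i + N * N * y i
      ≈⟨ +-cong (D-cong (D-cong (S.*-identityʳ y)) i) (*-congˡ (S.*-identityʳ y i)) ⟨
    D (D (y S.^ 1)) i + N * N * (y S.^ 1) i
      ≈⟨ D²-y^ 1 i ⟩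
    N * (N + N + 1#) * (y S.^ 2) i  ∎
    where
    open K-Solver using (_:+_; _:*_; _:-_; :-_; _:=_; con)
    N = ⟦ 1 ⟧

  scaledRow-suc : ∀ s k → ⟦ rowFactor (suc k) ⟧ · row s (suc k)
    ≋ ⟦ suc k ⟧ * ⟦ suc k ⟧ · (⟦ rowFactor k ⟧ · row s k) ⊕ D (D (⟦ rowFactor k ⟧ · row s k))
  scaledRow-suc s k i = begin
    ⟦ rowFactor (suc k) ⟧ * row s (suc k) i
      ≈⟨ *-congʳ (begin
           ⟦ rowFactor (suc k) ⟧
             ≈⟨ reflexive (≡.cong ⟦_⟧ (rowFactor-suc k)) ⟩
           ⟦ rowFactor k ℕ.* (suc k ℕ.* (suc k ℕ.+ suc k ℕ.+ 1)) ⟧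
             ≈⟨ trans (⟦⟧-* (rowFactor k) _) (*-congˡ (⟦⟧-* (suc k) (suc k ℕ.+ suc k ℕ.+ 1))) ⟩
           ρ * (N * ⟦ suc k ℕ.+ suc k ℕ.+ 1 ⟧)
             ≈⟨ *-congˡ (*-congˡ (trans (⟦⟧-+ (suc k ℕ.+ suc k) 1) (+-cong (⟦⟧-+ (suc k) (suc k)) ⟦1⟧))) ⟩
           ρ * (N * (N + N + 1#))  ∎) ⟩
    ρ * (N * (N + N + 1#)) * row s (suc k) i
      ≈⟨ *-assoc ρ _ _ ⟩
    ρ * (N * (N + N + 1#) * row s (suc k) i)
      ≈⟨ *-congˡ (D²-row s k i) ⟨
    ρ * (D (D (row s k)) i + N * N * row s k i)
      ≈⟨ K-Solver.solve 4 (λ c d n q → c :* (d :+ n :* n :* q) := n :* n :* (c :* q) :+ c :* d)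
           refl ρ (D (D (row s k)) i) N (row s k i) ⟩
    N * N * (ρ * row s k i) + ρ * D (D (row s k)) i
      ≈⟨ +-congˡ (S.trans (D-cong (D-· ρ (row s k))) (D-· ρ (D (row s k))) i) ⟨
    N * N * (ρ * row s k i) + D (D (ρ · row s k)) i  ∎
    where
    open K-Solver using (_:+_; _:*_; _:=_)
    ρ = ⟦ rowFactor k ⟧
    N = ⟦ suc k ⟧

  Ḧ-rows : ∀ s n → Ḧ n f[ s ]
    ≈ ∏ n (λ k → ⟦ rowFactor k ⟧) * det {n} (λ i j → egfCoeff (row s (toℕ i)) (toℕ j))
  Ḧ-rows s n = begin
    det {n} (λ i j → egfCoeff f[ s ] (2 ℕ.* toℕ i ℕ.+ toℕ j))
      ≈⟨ det-cong {n} (λ i j → egfCoeff-cong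
           (λ k → trans (*-congʳ ⟦1⟧) (*-identityˡ (f[ s ] k))) (2 ℕ.* toℕ i ℕ.+ toℕ j)) ⟨
    det {n} (λ i → R 0 (toℕ i))
      ≈⟨ det-newton n (λ k → ⟦ suc k ⟧ * ⟦ suc k ⟧) R step ⟩
    det {n} (λ i → R (toℕ i) 0)
      ≈⟨ det-cong {n} (λ i j → egfCoeff-· ⟦ rowFactor (toℕ i) ⟧ (row s (toℕ i)) (toℕ j)) ⟩
    det {n} (λ i j → ⟦ rowFactor (toℕ i) ⟧ * egfCoeff (row s (toℕ i)) (toℕ j))
      ≈⟨ det-scaleRows {n} (λ k → ⟦ rowFactor k ⟧) (λ i j → egfCoeff (row s (toℕ i)) (toℕ j)) ⟩
    ∏ n (λ k → ⟦ rowFactor k ⟧) * det {n} (λ i j → egfCoeff (row s (toℕ i)) (toℕ j))  ∎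
    where
    scaled : ℕ → Series
    scaled k = ⟦ rowFactor k ⟧ · row s k
    -- `R k i` holds the coefficients of `D²ⁱ (scaled k)`, so `det-newton` applies with `T = D²` and
    -- `αₖ = (k + 1)²`.
    R : ℕ → ℕ → Vector Carrier n
    R k i j = egfCoeff (scaled k) (2 ℕ.* i ℕ.+ toℕ j)
    step : ∀ k i j → R (suc k) i j ≈ ⟦ suc k ⟧ * ⟦ suc k ⟧ * R k i j + R k (suc i) j
    step k i j = begin
      egfCoeff (scaled (suc k)) t
        ≈⟨ egfCoeff-cong (scaledRow-suc s k) t ⟩
      egfCoeff (⟦ suc k ⟧ * ⟦ suc k ⟧ · scaled k ⊕ D (D (scaled k))) t
        ≈⟨ egfCoeff-⊕ (⟦ suc k ⟧ * ⟦ suc k ⟧ · scaled k) (D (D (scaled k))) t ⟩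
      egfCoeff (⟦ suc k ⟧ * ⟦ suc k ⟧ · scaled k) t + egfCoeff (D (D (scaled k))) t
        ≈⟨ +-cong (egfCoeff-· _ (scaled k) t)
                  (trans (egfCoeff-D (D (scaled k)) t) (egfCoeff-D (scaled k) (suc t))) ⟩
      ⟦ suc k ⟧ * ⟦ suc k ⟧ * R k i j + egfCoeff (scaled k) (suc (suc t))
        ≈⟨ +-congˡ (reflexive (≡.cong (λ m → egfCoeff (scaled k) (m ℕ.+ toℕ j)) (ℕ.*-suc 2 i))) ⟨
      ⟦ suc k ⟧ * ⟦ suc k ⟧ * R k i j + R k (suc i) j  ∎
      where t = 2 ℕ.* i ℕ.+ toℕ j

  -- That is, `f = a xⁿ + ⋯`. The coefficient `a` may be zero, as `1 - s (n choose 2)` is for some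
  -- `s`.
  Leading : ℕ → Series → Carrier → Set ℓ
  Leading n f a = (∀ k → k ℕ.< n → f k ≈ 0#) Product.× f n ≈ a

  leading-⊛ : ∀ {f g n a} → f 0 ≈ 0# → f 1 ≈ 1# → Leading n g a → Leading (suc n) (f ⊛ g) a
  leading-⊛ {f} {g} {n} {a} f₀≈0 f₁≈1 (below , at) = below′ , at′ n below at
    where
    shift : ∀ k → (f ⊛ g) (suc k) ≈ (tail f ⊛ g) k
    shift k = trans (+-congʳ (trans (*-congʳ f₀≈0) (zeroˡ _))) (+-identityˡ _)
    below′ : ∀ k → k ℕ.< suc n → (f ⊛ g) k ≈ 0#
    below′ zero    _             = trans (+-identityʳ _) (trans (*-congʳ f₀≈0) (zeroˡ _))
    below′ (suc k) (ℕ.s≤s k<n) = trans (shift k)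
      (⊛-vanish (tail f) g k λ i i≤k → below i (ℕ.≤-<-trans i≤k k<n))
    at′ : ∀ n → (∀ k → k ℕ.< n → g k ≈ 0#) → g n ≈ a → (f ⊛ g) (suc n) ≈ a
    at′ zero    _     at = trans (shift 0)
      (trans (+-identityʳ _) (trans (*-cong f₁≈1 at) (*-identityˡ a)))
    at′ (suc n) below at = trans (shift (suc n)) (trans
      (+-cong (trans (*-cong f₁≈1 at) (*-identityˡ a))
        (⊛-vanish (tail (tail f)) g n λ i i≤n → below i (ℕ.s≤s i≤n)))
      (+-identityʳ a))

  leading-resp : ∀ {f g n a} → f ≋ g → Leading n f a → Leading n g a
  leading-resp {n = n} f≋g (below , at) =
    (λ k k<n → trans (sym (f≋g k)) (below k k<n)) , trans (sym (f≋g n)) at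

  leading-^ : ∀ {f g a} → f 0 ≈ 0# → f 1 ≈ 1# → g 0 ≈ a → ∀ k → Leading k (f S.^ k ⊛ g) a
  leading-^ {f} {g} f₀≈0 f₁≈1 g₀≈a zero    = (λ _ ()) , trans (⊛-identityˡ g 0) g₀≈a
  leading-^ {f} {g} {a} f₀≈0 f₁≈1 g₀≈a (suc k) =
    leading-resp {f ⊛ (f S.^ k ⊛ g)} {f ⊛ f S.^ k ⊛ g} {suc k} {a}
      (S.sym (⊛-assoc f (f S.^ k) g))
      (leading-⊛ {f} {f S.^ k ⊛ g} {k} {a} f₀≈0 f₁≈1 (leading-^ {f} {g} f₀≈0 f₁≈1 g₀≈a k))

  egfCoeff-≈0 : ∀ f k → f k ≈ 0# → egfCoeff f k ≈ 0#
  egfCoeff-≈0 f k fₖ≈0 = begin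
    egfCoeff f k        ≈⟨ ×-congʳ (k !) (trans fₖ≈0 (sym (zeroˡ 0#))) ⟩
    (k !) × (0# * 0#)   ≈⟨ ×-comm-* (k !) 0# 0# ⟨
    0# * (k !) × 0#     ≈⟨ zeroˡ _ ⟩
    0#                  ∎

  -- The remaining determinant, for any `u = x + ⋯` and `y = 1/(1 - u)`.

  module _ {u y : Series} (u₀≈0 : u 0 ≈ 0#) (u₁≈1 : u 1 ≈ 1#) (y≋1+u⊛y : y ≋ one ⊕ u ⊛ y) where

    w : Series
    w = u ⊛ y

    w₀≈0 : w 0 ≈ 0#
    w₀≈0 = trans (+-identityʳ _) (trans (*-congʳ u₀≈0) (zeroˡ _))

    y₀≈1 : y 0 ≈ 1#
    y₀≈1 = trans (y≋1+u⊛y 0) (trans (+-congˡ w₀≈0) (+-identityʳ 1#))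

    w₁≈1 : w 1 ≈ 1#
    w₁≈1 = trans (+-cong (trans (*-congʳ u₀≈0) (zeroˡ (y 1)))
      (trans (+-identityʳ _) (trans (*-cong u₁≈1 y₀≈1) (*-identityˡ 1#)))) (+-identityˡ 1#)

    expand-powers : ∀ s m → expand (λ j → egfCoeff (y ⊕ s · u) (toℕ j))
             (λ (i : Fin m) j → egfCoeff (y S.^ suc (suc (toℕ i))) (toℕ j))
      ≈ ∏ m (λ k → ⟦ k ! ⟧) * (⟦ m ! ⟧ * (1# - s * ⟦ suc m C 2 ⟧))
    expand-powers s m = begin
      expand (λ j → egfCoeff (y ⊕ s · u) (toℕ j)) powers
        ≈⟨ expand-congˡ powers (λ j → egfCoeff-cong G₀ (toℕ j)) ⟩
      expand (λ j → egfCoeff (Gˢ 0) (toℕ j)) powers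
        ≈⟨ expand-congʳ (λ j → egfCoeff (Gˢ 0) (toℕ j)) powers shiftedPowers minors ⟩
      expand (λ j → egfCoeff (Gˢ 0) (toℕ j)) shiftedPowers
        ≈⟨ det-prepend m A G h step
             (λ k j j<k → egfCoeff-≈0 (Aˢ k) j (proj₁ (A-leading k) j j<k))
             (λ k j j<k → egfCoeff-≈0 (Gˢ k) j (proj₁ (G-leading k) j j<k)) ⟩
      ∏ m (λ k → A k k) * G m m
        -- Since `y² wᵏ = xᵏ + ⋯`, its coefficient of `xᵏ/k!` is `k !`.
        ≈⟨ *-cong (∏-cong m λ k → ×-congʳ (k !) (proj₂ (A-leading k)))
             (trans (×-congʳ (m !) (proj₂ (G-leading m)))
               (sym (trans (×-assoc-* (m !) 1# _) (×-congʳ (m !) (*-identityˡ _))))) ⟩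
      ∏ m (λ k → ⟦ k ! ⟧) * (⟦ m ! ⟧ * (1# - s * ⟦ suc m C 2 ⟧))  ∎
      where
      y² = y ⊛ (y ⊛ one)
      σ = const s
      t n : ℕ → Series
      t k = const ⟦ k C 2 ⟧
      n k = const ⟦ k ⟧
      -- (-1)ᵏ Gˢ k is what remains of y + s u = y² (1/y + s (1/y² - 1/y³)) when the
      -- second factor is expanded in powers of w = y - 1 up to wᵏ⁻¹.
      Aˢ Gˢ : ℕ → Series
      Aˢ k = w S.^ k ⊛ y²
      Gˢ k = w S.^ k ⊛ (y S.- σ ⊛ (t k ⊛ y ⊕ n k S.- u))
      A G : ℕ → ℕ → Carrier
      A k = egfCoeff (Aˢ k)
      G k = egfCoeff (Gˢ k)
      -- Up to the sign `(-1)ᵏ`, the coefficient of `wᵏ` in `1/y + s (1/y² - 1/y³)`, with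
      -- `k+1 choose 2` split by Pascal's rule.
      h : ℕ → Carrier
      h k = 1# - s * (⟦ k C 2 ⟧ + ⟦ k ⟧)
      powers shiftedPowers : Fin m → Vector Carrier (suc m)
      powers        i j = egfCoeff (y S.^ suc (suc (toℕ i))) (toℕ j)
      shiftedPowers i j = A (toℕ i) (toℕ j)

      ∏-cong : ∀ m {a b : ℕ → Carrier} → (∀ k → a k ≈ b k) → ∏ m a ≈ ∏ m b
      ∏-cong zero    a≈b = refl
      ∏-cong (suc m) a≈b = *-cong (a≈b 0) (∏-cong m (λ k → a≈b (suc k)))

      [1+k]C2 : ∀ k → suc k C 2 ≡ k ℕ.+ k C 2
      [1+k]C2 k = ≡.trans (≡.sym (nCk+nC[k+1]≡[n+1]C[k+1] k 1)) (≡.cong (ℕ._+ k C 2) (nC1≡n k))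

      ⟦[1+k]C2⟧ : ∀ k → ⟦ suc k C 2 ⟧ ≈ ⟦ k ⟧ + ⟦ k C 2 ⟧
      ⟦[1+k]C2⟧ k = trans (reflexive (≡.cong ⟦_⟧ ([1+k]C2 k))) (⟦⟧-+ k (k C 2))

      G₀ : (y ⊕ s · u) ≋ Gˢ 0
      G₀ = S.begin
        y ⊕ s · u
          S.≈⟨ S.+-congˡ {y} (const-⊛ s u) ⟨
        y ⊕ σ ⊛ u
          S.≈⟨ S.solve 3 (λ y σ x → y S.:+ σ S.:* x S.:= S.con 1ℚ S.:*
                 (y S.:- σ S.:* (S.con 0ℚ S.:* y S.:+ S.con 0ℚ S.:- x))) S.refl y σ u ⟩
        one ⊛ (y S.- σ ⊛ (S.0# ⊛ y ⊕ S.0# S.- u))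
          S.≈⟨ S.*-congˡ {one} (S.+-congˡ {y} (S.-‿cong (S.*-congˡ {σ} (S.+-congʳ {S.- u}
                 (S.+-cong (S.*-congʳ {y} const.0#-homo) const.0#-homo))))) ⟨
        Gˢ 0  S.∎

      step : ∀ k j → G k j ≈ h k * A k j + - G (suc k) j
      step k j = begin
        egfCoeff (Gˢ k) j
          ≈⟨ egfCoeff-cong (S.begin
               Gˢ k
                 S.≈⟨ DA.G-step {u} {y} y≋1+u⊛y (w S.^ k) σ (t k) (n k) ⟩
               (one S.- σ ⊛ (t k ⊕ n k)) ⊛ Aˢ k
                 S.- w S.^ suc k ⊛ (y S.- σ ⊛ ((n k ⊕ t k) ⊛ y ⊕ (one ⊕ n k) S.- u))
                 S.≈⟨ S.+-cong (S.*-congʳ {Aˢ k} (S.sym h≋)) (S.-‿cong (S.*-congˡ {w S.^ suc k}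
                        (S.+-congˡ {y} (S.-‿cong (S.*-congˡ {σ} (S.+-congʳ {S.- u}
                          (S.+-cong (S.*-congʳ {y} (S.sym t-suc)) (S.sym n-suc)))))))) ⟩
               const (h k) ⊛ Aˢ k S.- Gˢ (suc k)
                 S.≈⟨ S.+-congʳ {S.- Gˢ (suc k)} (const-⊛ (h k) (Aˢ k)) ⟩
               h k · Aˢ k S.- Gˢ (suc k)
                 S.≈⟨ S.+-congˡ {h k · Aˢ k} (λ i → sym (-1*x≈-x (Gˢ (suc k) i))) ⟩
               h k · Aˢ k ⊕ - 1# · Gˢ (suc k)  S.∎) j ⟩
        egfCoeff (h k · Aˢ k ⊕ - 1# · Gˢ (suc k)) j
          ≈⟨ egfCoeff-⊕ (h k · Aˢ k) (- 1# · Gˢ (suc k)) j ⟩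
        egfCoeff (h k · Aˢ k) j + egfCoeff (- 1# · Gˢ (suc k)) j
          ≈⟨ +-cong (egfCoeff-· (h k) (Aˢ k) j)
               (trans (egfCoeff-· (- 1#) (Gˢ (suc k)) j) (-1*x≈-x _)) ⟩
        h k * A k j + - G (suc k) j  ∎
        where
        n-suc : n (suc k) ≋ one ⊕ n k
        n-suc = S.trans (const.+-homo 1# ⟦ k ⟧) (S.+-congʳ {n k} (S.sym one≋const))
        t-suc : t (suc k) ≋ n k ⊕ t k
        t-suc = S.trans (const.⟦⟧-cong (⟦[1+k]C2⟧ k)) (const.+-homo ⟦ k ⟧ ⟦ k C 2 ⟧)
        h≋ : const (h k) ≋ one S.- σ ⊛ (t k ⊕ n k)
        h≋ = S.trans (const.+-homo 1# _) (S.+-cong (S.sym one≋const)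
          (S.trans (const.-‿homo _) (S.-‿cong (S.trans (const.*-homo s _)
            (S.*-congˡ {σ} (const.+-homo ⟦ k C 2 ⟧ ⟦ k ⟧))))))

      A-leading : ∀ k → Leading k (Aˢ k) 1#
      A-leading k = leading-^ {w} {y²} w₀≈0 w₁≈1 (trans (+-identityʳ _) (trans (*-cong y₀≈1
        (trans (S.*-identityʳ y 0) y₀≈1)) (*-identityˡ 1#))) k

      G-leading : ∀ k → Leading k (Gˢ k) (1# - s * ⟦ suc k C 2 ⟧)
      G-leading k = leading-^ {w} {y S.- σ ⊛ (t k ⊛ y ⊕ n k S.- u)} w₀≈0 w₁≈1
        (+-cong y₀≈1 (-‿cong (trans (+-identityʳ _) (*-congˡ (begin
        (⟦ k C 2 ⟧ * y 0 + 0#) + ⟦ k ⟧ + - u 0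
          ≈⟨ +-cong (+-congʳ (trans (+-identityʳ _) (trans (*-congˡ y₀≈1) (*-identityʳ _))))
                    (trans (-‿cong u₀≈0) -0#≈0#) ⟩
        ⟦ k C 2 ⟧ + ⟦ k ⟧ + 0#
          ≈⟨ trans (+-identityʳ _) (+-comm _ _) ⟩
        ⟦ k ⟧ + ⟦ k C 2 ⟧
          ≈⟨ ⟦[1+k]C2⟧ k ⟨
        ⟦ suc k C 2 ⟧  ∎))))) k

      -- An application of `det-newton` with `T` multiplication by `y` and every `αₖ = -1`, so that
      -- `pₖ(T)` is multiplication by `wᵏ`. It acts on each cofactor because the first row stays as
      -- it is.
      minors : ∀ j → cofactor powers j ≈ cofactor shiftedPowers j
      minors j = begin
        det (λ i l → powers i (punchIn j l))
          ≈⟨ det-cong (λ i l → egfCoeff-cong (S.*-identityˡ (y S.^ suc (suc (toℕ i)))) (toℕ (punchIn j l))) ⟨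
        det (λ i → R 0 (toℕ i))
          ≈⟨ det-newton m (λ _ → - 1#) R newton-step ⟩
        det (λ i l → shiftedPowers i (punchIn j l))  ∎
        where
        R : ℕ → ℕ → Vector Carrier m
        R k i l = egfCoeff (w S.^ k ⊛ (y S.^ suc (suc i))) (toℕ (punchIn j l))
        newton-step : ∀ k i l → R (suc k) i l ≈ - 1# * R k i l + R k (suc i) l
        newton-step k i l = begin
          egfCoeff (w S.^ suc k ⊛ Y) e
            ≈⟨ egfCoeff-cong (S.trans (DA.w*-step {u} {y} y≋1+u⊛y (w S.^ k) Y)
                 (S.+-congʳ {w S.^ k ⊛ (y ⊛ Y)} (S.trans
                   (S.*-congʳ {w S.^ k ⊛ Y} (S.trans (S.-‿cong one≋const) (S.sym (const.-‿homo 1#))))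
                   (const-⊛ (- 1#) (w S.^ k ⊛ Y))))) e ⟩
          egfCoeff (- 1# · (w S.^ k ⊛ Y) ⊕ w S.^ k ⊛ (y ⊛ Y)) e
            ≈⟨ egfCoeff-⊕ (- 1# · (w S.^ k ⊛ Y)) (w S.^ k ⊛ (y ⊛ Y)) e ⟩
          egfCoeff (- 1# · (w S.^ k ⊛ Y)) e + R k (suc i) l
            ≈⟨ +-congʳ (egfCoeff-· (- 1#) (w S.^ k ⊛ Y) e) ⟩
          - 1# * R k i l + R k (suc i) l  ∎
          where
          Y = y S.^ suc (suc i)
          e = toℕ (punchIn j l)

  ∏-⟦⟧ : ∀ n a → ∏ n (λ k → ⟦ a k ⟧) ≈ ⟦ product (applyUpTo a n) ⟧
  ∏-⟦⟧ zero    a = sym ⟦1⟧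
  ∏-⟦⟧ (suc n) a = trans (*-congˡ (∏-⟦⟧ n (a ∘ suc))) (sym (⟦⟧-* (a 0) _))

  Ḧ-f[s] : ∀ s n → 1 ℕ.≤ n → Ḧ n f[ s ] ≈ (1# - s * ⟦ n C 2 ⟧) * ⟦ hankelProduct n ⟧
  Ḧ-f[s] s (suc m) _ = begin
    Ḧ (suc m) f[ s ]
      -- For `n = m + 1` the determinant unfolds to the expansion along `f[ s ] = y ⊕ s · sin` over
      -- the `m` rows `y², …, y ^ (m + 1)`.
      ≈⟨ trans (Ḧ-rows s (suc m)) (*-congˡ (expand-powers {sin} {y} sin₀≈0 sin₁≈1 y≋1+sin⊛y s m)) ⟩
    ∏ (suc m) (λ k → ⟦ rowFactor k ⟧) * (∏ m (λ k → ⟦ k ! ⟧) * (⟦ m ! ⟧ * V))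
      ≈⟨ *-cong (∏-⟦⟧ (suc m) rowFactor) (*-congʳ (∏-⟦⟧ m _!)) ⟩
    ⟦ p ⟧ * (⟦ q ⟧ * (⟦ m ! ⟧ * V))
      ≈⟨ K-Solver.solve 4 (λ p q f v → p :* (q :* (f :* v)) := v :* (p :* (q :* f))) refl
           ⟦ p ⟧ ⟦ q ⟧ ⟦ m ! ⟧ V ⟩
    V * (⟦ p ⟧ * (⟦ q ⟧ * ⟦ m ! ⟧))
      ≈⟨ *-congˡ (trans (⟦⟧-* p (q ℕ.* m !)) (*-congˡ (⟦⟧-* q (m !)))) ⟨
    V * ⟦ p ℕ.* (q ℕ.* m !) ⟧
      ≈⟨ *-congˡ (reflexive (≡.cong ⟦_⟧ (≡.trans
           (≡.cong (p ℕ.*_) (≡.sym (product-applyUpTo-snoc _! m))) (hankelProduct-factors m)))) ⟩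
    V * ⟦ hankelProduct (suc m) ⟧  ∎
    where
    open K-Solver using (_:*_; _:=_)
    V = 1# - s * ⟦ suc m C 2 ⟧
    p = product (applyUpTo rowFactor (suc m))
    q = product (applyUpTo _! m)

  Ḧ-f[-1] : ∀ n → 1 ℕ.≤ n → Ḧ n f[ - 1# ] ≈ ⟦ n C 2 ℕ.+ 1 ⟧ * ⟦ hankelProduct n ⟧
  Ḧ-f[-1] n 1≤n = trans (Ḧ-f[s] (- 1#) n 1≤n) (*-congʳ (begin
    1# - - 1# * ⟦ n C 2 ⟧    ≈⟨ +-congˡ (trans (-‿cong (-1*x≈-x _)) (-‿involutive _)) ⟩
    1# + ⟦ n C 2 ⟧           ≈⟨ +-comm 1# _ ⟩
    ⟦ n C 2 ⟧ + 1#           ≈⟨ +-congˡ ⟦1⟧ ⟨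
    ⟦ n C 2 ⟧ + ⟦ 1 ⟧        ≈⟨ ⟦⟧-+ (n C 2) 1 ⟨
    ⟦ n C 2 ℕ.+ 1 ⟧          ∎))

open import Data.Nat.Base using (_≤_; _+_)
open import Data.Product.Base using (_×_)
open CommutativeRing ℂ-commutativeRing using (_≈_; _*_; -_; _-_; 1#)
open ℂ-Series using (Ḧ; f[_]; ⟨sin³+1⟩/cos²; _≋_; ⟦_⟧)

proposition15p1 : (∀ (s : ℂ) (n : ℕ) → 1 ≤ n →
    Ḧ n f[ s ] ≈ (1# - s * ⟦ n C 2 ⟧) * ⟦ hankelProduct n ⟧)
    × (f[ - 1# ] ≋ ⟨sin³+1⟩/cos²)
    × (∀ (n : ℕ) → 1 ≤ n →
    Ḧ n f[ - 1# ] ≈ ⟦ (n C 2 + 1) ⟧ * ⟦ hankelProduct n ⟧)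
proposition15p1 = Ḧ-f[s] , f₋₁≋ , Ḧ-f[-1]
  where open Hankel ℂ-commutativeRing fromℚ fromℚ-isRingHomomorphism
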